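{- Let $$\mathrm{GF}_{\Lambda_{\{1_R\}}}(y_1,y_2,y_3):=\sum_{\lambda\in\Lambda_{\{1_R\}}} y_1^{\mathrm{len}_R(\lambda)}\,y_2^{\mathrm{len}_G(\lambda)}\,y_3^{\mathrm{len}_B(\lambda)}\,q^{|\lambda|}$$ and $$T(y_1,y_2,y_3):=\sum_{n_1,n_2,n_3\ge 0} q^{3\binom{n_1}{2}+\binom{n_2}{2}+\binom{n_3}{2}+n_1n_2+n_2n_3+n_3n_1}\,\frac{y_1^{n_1}y_2^{n_2}y_3^{n_3}\,(-q;q)_{n_1+n_2+n_3}}{(q^2;q^2)_{n_1}(q^2;q^2)_{n_2}(q^2;q^2)_{n_3}}.$$ Then $$\mathrm{GF}_{\Lambda_{\{1_R\}}}(y^2,y,y)=(1+yq)\,T(y^2q^4,\,yq^2,\,yq).$$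
   Context: A three-colored partition is a finite (possibly empty) partition into positive integer parts in which each part is assigned one of three colors: red, green, blue, indicated by subscripts $R,G,B$ (so $j_R$ is a red part of size $j$, etc.). For a three-colored partition $\lambda$, $|\lambda|$ is the sum of its parts, and $\mathrm{len}_R(\lambda),\mathrm{len}_G(\lambda),\mathrm{len}_B(\lambda)$ are the numbers of red, green and blue parts, respectively. $\Lambda$ is the set of three-colored partitions (including the empty one) such that: (i) each part size, counting all three colors together, appears at most once; (ii) for every $j\ge 1$, none of the following pairs of parts both occur: $j_R$ and $(j+1)_R$; $j_R$ and $(j+2)_R$; $j_R$ and $(j+1)_B$; $j_G$ and $(j+1)_R$; $j_G$ and $(j+2)_R$; $j_G$ and $(j+1)_B$; $j_B$ and $(j+1)_R$; $j_B$ and $(j+1)_G$. $\Lambda_{\{1_R\}}$ is the subset of $\Lambda$ consisting of the partitions in which the part $1_R$ does not occur. The $q$-Pochhammer symbol is $(A;q)_n:=\prod_{k=0}^{n-1}(1-Aq^k)$ for $n\in\mathbb{N}\cup\{\infty\}$. The identity is between formal power series in $y,q$. -}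

module Defs where

open import Algebra.Bundles using (RawRing)
import Algebra.Definitions.RawSemiring as RawSemiringDefinitions
open import Data.Integer.Base as ℤ using (ℤ; 0ℤ; 1ℤ)
open import Data.List.Base using (List; applyUpTo; filter; foldr; length; map)
open import Data.List.Membership.Propositional using (_∈_; _∉_)
open import Data.List.Relation.Unary.All using (All)
open import Data.List.Relation.Unary.Linked using (Linked)
open import Data.List.Relation.Unary.Unique.Propositional using (Unique)
open import Data.Nat.Base as ℕ using (ℕ; zero; suc)
open import Data.Nat.ListAction using (sum)
open import Data.Nat.Combinatorics using (_C_)
open import Data.Product.Base using (∃-syntax; _×_; _,_; proj₁; proj₂)
open import Data.Refinement using (Refinement-syntax; value)
open import Data.Sum.Base using (_⊎_)
open import Level using (0ℓ)
open import Relation.Binary.Definitions using (DecidableEquality)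
open import Relation.Binary.PropositionalEquality.Core using (_≡_; refl)
open import Relation.Nullary using (¬_; yes; no)
open import Relation.Unary using (Pred)

------------------------------------------------------------------------
-- Formal power series in y and q

-- ℤ[[y,q]]: f m n is the coefficient of y^m q^n.
Series : Set
Series = ℕ → ℕ → ℤ

sumℤ : List ℤ → ℤ
sumℤ = foldr ℤ._+_ 0ℤ

seriesRawRing : RawRing 0ℓ 0ℓ
seriesRawRing = record
  { Carrier = Series
  ; _≈_     = λ f g → ∀ m n → f m n ≡ g m n
  ; _+_     = λ f g m n → f m n ℤ.+ g m n
  ; _*_     = λ f g m n →
      sumℤ (applyUpTo (λ i →
        sumℤ (applyUpTo (λ j → f i j ℤ.* g (m ℕ.∸ i) (n ℕ.∸ j)) (suc n)))
        (suc m))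
  ; -_      = λ f m n → ℤ.- f m n
  ; 0#      = λ _ _ → 0ℤ
  ; 1#      = λ { zero zero → 1ℤ ; _ _ → 0ℤ }
  }

open RawRing seriesRawRing public using (_≈_; _+_; _*_; -_; 0#; 1#)
open RawSemiringDefinitions (RawRing.rawSemiring seriesRawRing) public
  using (_^_)

infixl 6 _-_
_-_ : Series → Series → Series
f - g = f + - g

y : Series
y 1 0 = 1ℤ
y _ _ = 0ℤ

q : Series
q 0 1 = 1ℤ
q _ _ = 0ℤ

-- Reciprocal of a series g with constant term 1, as the geometric series
-- Σ_k (1 - g)^k.  The k-th power has no terms of total degree below k, so
-- the coefficient of y^m q^n only receives contributions from k ≤ m + n.
-- (The value is meaningless for other constant terms.)
infixl 7 _/_
_/_ : Series → Series → Series
f / g = f * λ m n → sumℤ (applyUpTo (λ k → ((1# - g) ^ k) m n) (suc (m ℕ.+ n)))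

-- (a; p)_n
pochhammer : Series → Series → ℕ → Series
pochhammer a p zero    = 1#
pochhammer a p (suc n) = pochhammer a p n * (1# - a * p ^ n)

-- S is the sum of the family f: for each monomial only finitely many members
-- of f have a non-zero coefficient, and these coefficients add up to that
-- of S.
HasSum : {I : Set} → (I → Series) → Series → Set
HasSum {I} f S = ∀ m n → ∃[ is ]
  Unique {A = I} is ×
  (∀ i → i ∉ is → f i m n ≡ 0ℤ) ×
  sumℤ (map (λ i → f i m n) is) ≡ S m n

------------------------------------------------------------------------
-- Three-colored partitions

data Color : Set where
  R G B : Color

_≟ᶜ_ : DecidableEquality Color
R ≟ᶜ R = yes refl
R ≟ᶜ G = no λ ()
R ≟ᶜ B = no λ ()
G ≟ᶜ R = no λ ()
G ≟ᶜ G = yes refl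
G ≟ᶜ B = no λ ()
B ≟ᶜ R = no λ ()
B ≟ᶜ G = no λ ()
B ≟ᶜ B = yes refl

-- (j , c) is the part j_c.
Part : Set
Part = ℕ × Color

size : Part → ℕ
size = proj₁

color : Part → Color
color = proj₂

rank : Color → ℕ
rank R = 0
rank G = 1
rank B = 2

-- A total order on parts.  Ties between equal sizes are broken by an arbitrary
-- order on colors, only so that each multiset of parts is listed in one way.
_≽_ : Part → Part → Set
a ≽ b = size a ℕ.> size b ⊎ (size a ≡ size b × rank (color a) ℕ.≥ rank (color b))

-- The proofs in a refinement type are irrelevant, so two partitions are equal
-- as soon as their lists of parts are.
ColoredPartition : Set
ColoredPartition = [ as ∈ List Part ∣ All (λ a → 1 ℕ.≤ size a) as × Linked _≽_ as ]

parts : ColoredPartition → List Part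
parts = value

∣_∣ : ColoredPartition → ℕ
∣ π ∣ = sum (map size (parts π))

len : Color → ColoredPartition → ℕ
len c π = length (filter (λ a → color a ≟ᶜ c) (parts π))

data Forbidden : Part → Part → Set where
  R1R : ∀ {j} → 1 ℕ.≤ j → Forbidden (j , R) (1 ℕ.+ j , R)
  R2R : ∀ {j} → 1 ℕ.≤ j → Forbidden (j , R) (2 ℕ.+ j , R)
  R1B : ∀ {j} → 1 ℕ.≤ j → Forbidden (j , R) (1 ℕ.+ j , B)
  G1R : ∀ {j} → 1 ℕ.≤ j → Forbidden (j , G) (1 ℕ.+ j , R)
  G2R : ∀ {j} → 1 ℕ.≤ j → Forbidden (j , G) (2 ℕ.+ j , R)
  G1B : ∀ {j} → 1 ℕ.≤ j → Forbidden (j , G) (1 ℕ.+ j , B)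
  B1R : ∀ {j} → 1 ℕ.≤ j → Forbidden (j , B) (1 ℕ.+ j , R)
  B1G : ∀ {j} → 1 ℕ.≤ j → Forbidden (j , B) (1 ℕ.+ j , G)

Λ : Pred ColoredPartition 0ℓ
Λ π = Unique (map size (parts π)) ×
      (∀ {a b} → Forbidden a b → ¬ (a ∈ parts π × b ∈ parts π))

Λ⟨1R⟩ : Pred ColoredPartition 0ℓ
Λ⟨1R⟩ π = Λ π × (1 , R) ∉ parts π

------------------------------------------------------------------------
-- The two sums

-- S = GF(y₁, y₂, y₃), where GF is the generating function of Λ⟨1R⟩.
IsGF : (y₁ y₂ y₃ S : Series) → Set
IsGF y₁ y₂ y₃ = HasSum {[ π ∈ ColoredPartition ∣ Λ⟨1R⟩ π ]} λ x →
  let π = value x in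
  y₁ ^ len R π * y₂ ^ len G π * y₃ ^ len B π * q ^ ∣ π ∣

-- S = T(y₁, y₂, y₃)
IsT : (y₁ y₂ y₃ S : Series) → Set
IsT y₁ y₂ y₃ = HasSum {ℕ × ℕ × ℕ} λ (n₁ , n₂ , n₃) →
  q ^ (3 ℕ.* (n₁ C 2) ℕ.+ (n₂ C 2) ℕ.+ (n₃ C 2)
         ℕ.+ n₁ ℕ.* n₂ ℕ.+ n₂ ℕ.* n₃ ℕ.+ n₃ ℕ.* n₁) *
  ((y₁ ^ n₁ * y₂ ^ n₂ * y₃ ^ n₃ * pochhammer (- q) q (n₁ ℕ.+ n₂ ℕ.+ n₃)) /
   (pochhammer (q ^ 2) (q ^ 2) n₁ * pochhammer (q ^ 2) (q ^ 2) n₂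
      * pochhammer (q ^ 2) (q ^ 2) n₃))

-- Write T(a,b,c) for the triple sum with weights a, b, c.  Its summands satisfy
-- first-order recurrences in each index, whence contiguous relations such as
--   T(a,b,c) = T(a,bq²,c) + b (T(aq,bq,cq) + q T(aq²,bq²,cq²)),
-- and, splitting the last factor off the numerator (-q;q)_{n₁+n₂+n₃},
--   T(a,b,c) = T(aq,bq,cq) + (a + b) T(aq³,bq,cq) + c T(aq³,bq³,cq).
-- A partition in Λ is built from its smallest part upwards by an automaton with
-- four states.  If a, b, c are the weights of a red, green, blue part of the next
-- size, the series of all continuations are T(aq²,b,cq) after a red or green part,
-- T(aq,bq,c) after a blue part, T(aq,bq,c) + b T(aq³,bq,cq²) if just the red part
-- is excluded, and this plus a T(aq³,bq,cq²) if nothing is: the contiguous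
-- relations are exactly the transfer equations.  The third series, at size 1,
-- counts the partitions without 1_R; for aq = bc it equals (1 + b) T(aq³,bq,c).

module Submission where

-- The transfer equations alone do not identify their solution; a limit does. After the sizes 1 to
-- `n` there are finitely many configurations, each carrying the weight of its parts times the
-- series of its state. The transfer equations conserve the total of these products, and the state
-- series at size n + 1 are 1 modulo q^(n+1), so at q^n the conserved total is the count of
-- partitions. No infinite series of continuations has to be constructed.
--
-- The relation from the numerator rests on a companion summand V that ends in (-q;q)_(N-1), where N
-- = i+j+k. It satisfies (1 - q^N) E = (1 - q^(2N)) V for the summand E of T, and 1 - q^(2N)
-- telescopes into multiples of 1 - q^(2i), 1 - q^(2j), 1 - q^(2k), each of which cancels a
-- denominator factor.
--
-- Three gradings are at work: total degree for reciprocals, y-degree for the triple sum, q-degree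
-- for the limit. Recurrences are written without subtraction, so that the algebra takes place in a
-- commutative semiring.

open import Algebra.Bundles using (CommutativeRing)
import Algebra.Properties.CommutativeSemigroup as CommutativeSemigroupProperties
import Algebra.Properties.Semiring.Exp as Exp
open import Algebra.Structures using (IsCommutativeRing)
open import Data.Empty using (⊥-elim; ⊥-elim-irr)
open import Data.Integer.Base as ℤ using (ℤ; 0ℤ)
import Data.Integer.Properties as ℤ
open import Data.Irrelevant using ([_])
open import Data.List.Base
  using (List; []; _∷_; _++_; applyUpTo; cartesianProduct; concatMap; filter; foldr; length; map; upTo)
open import Data.List.Membership.Propositional using (_∈_; _∉_)
open import Data.List.Membership.Propositional.Properties
  using (∈-cartesianProduct⁺; ∈-concatMap⁺; ∈-map⁺; ∈-upTo⁺)
open import Data.List.Properties using (map-++; map-cong; map-upTo; map-∘)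
open import Data.List.Relation.Unary.All as All using (All; []; _∷_)
import Data.List.Relation.Unary.All.Properties as All
open import Data.List.Relation.Unary.AllPairs as AllPairs using (AllPairs; []; _∷_)
import Data.List.Relation.Unary.AllPairs.Properties as AllPairs
open import Data.List.Relation.Unary.Any as Any using (here; there)
open import Data.List.Relation.Unary.Linked as Linked using (Linked; []; [-]; _∷_)
open import Data.List.Relation.Unary.Linked.Properties using (Linked⇒AllPairs)
open import Data.List.Relation.Unary.Unique.Propositional using (Unique)
open import Data.List.Relation.Unary.Unique.Propositional.Properties using (cartesianProduct⁺; upTo⁺)
open import Data.Nat.Base as ℕ using (ℕ; zero; suc; _≤_; _<_; _>_; z≤n; s≤s; z<s)
open import Data.Nat.Combinatorics using (_C_; nC1≡n; nCk+nC[k+1]≡[n+1]C[k+1])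
open import Data.Nat.ListAction using () renaming (sum to sumℕ)
import Data.Nat.Properties as ℕ
open import Data.Nat.Solver using (module +-*-Solver)
open import Data.Product.Base using (∃-syntax; _×_; _,_)
open import Data.Refinement using (Refinement-syntax; value; _,_)
open import Data.Sum.Base using (_⊎_; inj₁; inj₂)
open import Function.Base using (_∘_)
open import Level using (0ℓ)
open import Relation.Binary.PropositionalEquality.Core as ≡ using (_≡_; _≢_)
open import Relation.Binary.PropositionalEquality.Properties as ≡ using ()
open import Relation.Nullary using (¬_; contradiction; yes; no)

-- Commutative rings and formal power series over them

module RingLemmas (A : CommutativeRing 0ℓ 0ℓ) where
  open CommutativeRing A
  open import Algebra.Properties.CommutativeSemiring.Exp commutativeSemiring
  open import Algebra.Properties.Ring ring using (-‿distribˡ-*; -‿involutive)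
  open import Algebra.Solver.Ring.NaturalCoefficients.Default commutativeSemiring
    using (solve; _:=_; _:+_; _:*_; con)
  open import Relation.Binary.Reasoning.Setoid setoid

  x+[1-x]≈1 : ∀ x → x + (1# - x) ≈ 1#
  x+[1-x]≈1 x = begin
    x + (1# - x)    ≈⟨ +-comm _ _ ⟩
    1# - x + x      ≈⟨ +-assoc _ _ _ ⟩
    1# + (- x + x)  ≈⟨ +-congˡ (-‿inverseˡ x) ⟩
    1# + 0#         ≈⟨ +-identityʳ 1# ⟩
    1#              ∎

  -- One more term of the geometric series in h = 1 - g: `s` is a partial sum of powers of `h`, and
  -- `p` is the remainder, which gets multiplied by `h`.
  geometric-step : ∀ {g h s p} → g + h ≈ 1# → g * s + p ≈ 1# →
                   g * (1# + h * s) + h * p ≈ 1#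
  geometric-step {g} {h} {s} {p} g+h≈1 gs+p≈1 = begin
    g * (1# + h * s) + h * p
      ≈⟨ solve 4 (λ g h s p → g :* (con 1 :+ h :* s) :+ h :* p := g :+ h :* (g :* s :+ p))
           refl g h s p ⟩
    g + h * (g * s + p)    ≈⟨ +-congˡ (*-congˡ gs+p≈1) ⟩
    g + h * 1#             ≈⟨ +-congˡ (*-identityʳ h) ⟩
    g + h                  ≈⟨ g+h≈1 ⟩
    1#                     ∎

  1--xy : ∀ x y → 1# - (- x) * y ≈ 1# + x * y
  1--xy x y = +-congˡ (trans (-‿cong (sym (-‿distribˡ-* x y))) (-‿involutive (x * y)))

  square-^ : ∀ x n → (x ^ 2) * (x ^ 2) ^ n ≈ x * x ^ n * (x * x ^ n)
  square-^ x n = begin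
    x ^ 2 * (x ^ 2) ^ n              ≡⟨⟩
    (x ^ 2) ^ suc n                  ≈⟨ ^-congˡ (suc n) (*-congˡ (*-identityʳ x)) ⟩
    (x * x) ^ suc n                  ≈⟨ ^-distrib-* x x (suc n) ⟩
    x ^ suc n * x ^ suc n            ∎

  den-step : ∀ d {e e′} → e ≈ e′ → d * (1# - e) + d * e′ ≈ d
  den-step d {e} {e′} e≈e′ = begin
    d * (1# - e) + d * e′    ≈⟨ +-congˡ (*-congˡ e≈e′) ⟨
    d * (1# - e) + d * e     ≈⟨ distribˡ _ _ _ ⟨
    d * (1# - e + e)         ≈⟨ *-congˡ (trans (+-comm _ _) (x+[1-x]≈1 e)) ⟩
    d * 1#                   ≈⟨ *-identityʳ d ⟩
    d                        ∎

-- Applied to the integers and then to its own result, this gives series in y over series in q, so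
-- that each ring law is proved for a single convolution.
module PowerSeries {c ℓ} (A : CommutativeRing c ℓ) where
  open CommutativeRing A
  open import Relation.Binary.Reasoning.Setoid setoid
  open import Algebra.Properties.CommutativeSemigroup +-commutativeSemigroup
    using (interchange)

  infixl 7 _⊛_

  Σ[_] : (ℕ → Carrier) → ℕ → Carrier
  Σ[ f ] n = foldr _+_ 0# (applyUpTo f n)

  _⊛_ : (ℕ → Carrier) → (ℕ → Carrier) → ℕ → Carrier
  (f ⊛ g) n = Σ[ (λ i → f i * g (n ℕ.∸ i)) ] (suc n)

  infix 4 _≋_
  _≋_ : (ℕ → Carrier) → (ℕ → Carrier) → Set ℓ
  f ≋ g = ∀ n → f n ≈ g n

  ⊛-cong : ∀ {f f′ g g′} → f ≋ f′ → g ≋ g′ → f ⊛ g ≋ f′ ⊛ g′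
  ⊛-cong p r zero    = +-congʳ (*-cong (p 0) (r 0))
  ⊛-cong p r (suc n) = +-cong (*-cong (p 0) (r (suc n))) (⊛-cong (p ∘ suc) r n)

  -- The definition unfolds at the low end of `f`; peeling off the other end is what makes
  -- commutativity go by induction.
  ⊛-suc : ∀ f g n → (f ⊛ g) (suc n) ≈ (f ⊛ (g ∘ suc)) n + f (suc n) * g 0
  ⊛-suc f g zero    = begin
    f 0 * g 1 + (f 1 * g 0 + 0#)  ≈⟨ +-congˡ (+-identityʳ _) ⟩
    f 0 * g 1 + f 1 * g 0         ≈⟨ +-congʳ (+-identityʳ _) ⟨
    f 0 * g 1 + 0# + f 1 * g 0    ∎
  ⊛-suc f g (suc n) = begin
    f 0 * g (2 ℕ.+ n) + ((f ∘ suc) ⊛ g) (suc n)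
      ≈⟨ +-congˡ (⊛-suc (f ∘ suc) g n) ⟩
    f 0 * g (2 ℕ.+ n) + (((f ∘ suc) ⊛ (g ∘ suc)) n + f (2 ℕ.+ n) * g 0)
      ≈⟨ +-assoc _ _ _ ⟨
    f 0 * g (2 ℕ.+ n) + ((f ∘ suc) ⊛ (g ∘ suc)) n + f (2 ℕ.+ n) * g 0 ∎

  ⊛-comm : ∀ f g → f ⊛ g ≋ g ⊛ f
  ⊛-comm f g zero    = +-congʳ (*-comm (f 0) (g 0))
  ⊛-comm f g (suc n) = begin
    f 0 * g (suc n) + ((f ∘ suc) ⊛ g) n  ≈⟨ +-cong (*-comm _ _) (⊛-comm (f ∘ suc) g n) ⟩
    g (suc n) * f 0 + (g ⊛ (f ∘ suc)) n  ≈⟨ +-comm _ _ ⟩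
    (g ⊛ (f ∘ suc)) n + g (suc n) * f 0  ≈⟨ ⊛-suc g f n ⟨
    (g ⊛ f) (suc n)                      ∎

  ⊛-distribʳ : ∀ h f g → (λ n → f n + g n) ⊛ h ≋ (λ n → (f ⊛ h) n + (g ⊛ h) n)
  ⊛-distribʳ h f g zero    = begin
    (f 0 + g 0) * h 0 + 0#               ≈⟨ +-cong (distribʳ _ _ _) (sym (+-identityʳ _)) ⟩
    f 0 * h 0 + g 0 * h 0 + (0# + 0#)    ≈⟨ interchange _ _ _ _ ⟩
    f 0 * h 0 + 0# + (g 0 * h 0 + 0#)    ∎
  ⊛-distribʳ h f g (suc n) = begin
    (f 0 + g 0) * h (suc n) + ((λ i → f (suc i) + g (suc i)) ⊛ h) n
      ≈⟨ +-cong (distribʳ _ _ _) (⊛-distribʳ h (f ∘ suc) (g ∘ suc) n) ⟩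
    f 0 * h (suc n) + g 0 * h (suc n) + (((f ∘ suc) ⊛ h) n + ((g ∘ suc) ⊛ h) n)
      ≈⟨ interchange _ _ _ _ ⟩
    f 0 * h (suc n) + ((f ∘ suc) ⊛ h) n + (g 0 * h (suc n) + ((g ∘ suc) ⊛ h) n) ∎

  ⊛-scaleˡ : ∀ a f g → (λ n → a * f n) ⊛ g ≋ (λ n → a * (f ⊛ g) n)
  ⊛-scaleˡ a f g zero    = begin
    a * f 0 * g 0 + 0#          ≈⟨ +-cong (*-assoc _ _ _) (sym (zeroʳ a)) ⟩
    a * (f 0 * g 0) + a * 0#    ≈⟨ distribˡ _ _ _ ⟨
    a * (f 0 * g 0 + 0#)        ∎
  ⊛-scaleˡ a f g (suc n) = begin
    a * f 0 * g (suc n) + ((λ i → a * f (suc i)) ⊛ g) n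
      ≈⟨ +-cong (*-assoc _ _ _) (⊛-scaleˡ a (f ∘ suc) g n) ⟩
    a * (f 0 * g (suc n)) + a * ((f ∘ suc) ⊛ g) n
      ≈⟨ distribˡ _ _ _ ⟨
    a * (f 0 * g (suc n) + ((f ∘ suc) ⊛ g) n) ∎

  ⊛-assoc : ∀ f g h → (f ⊛ g) ⊛ h ≋ f ⊛ (g ⊛ h)
  ⊛-assoc f g h zero    = +-congʳ (begin
    (f 0 * g 0 + 0#) * h 0    ≈⟨ *-congʳ (+-identityʳ _) ⟩
    f 0 * g 0 * h 0           ≈⟨ *-assoc _ _ _ ⟩
    f 0 * (g 0 * h 0)         ≈⟨ *-congˡ (+-identityʳ _) ⟨
    f 0 * (g 0 * h 0 + 0#)    ∎)
  ⊛-assoc f g h (suc n) = begin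
    (f 0 * g 0 + 0#) * h (suc n) + ((λ i → f 0 * g (suc i) + ((f ∘ suc) ⊛ g) i) ⊛ h) n
      ≈⟨ +-cong (trans (*-congʳ (+-identityʳ _)) (*-assoc _ _ _)) (begin
           ((λ i → f 0 * g (suc i) + ((f ∘ suc) ⊛ g) i) ⊛ h) n
             ≈⟨ ⊛-distribʳ h (λ i → f 0 * g (suc i)) ((f ∘ suc) ⊛ g) n ⟩
           ((λ i → f 0 * g (suc i)) ⊛ h) n + (((f ∘ suc) ⊛ g) ⊛ h) n
             ≈⟨ +-cong (⊛-scaleˡ (f 0) (g ∘ suc) h n) (⊛-assoc (f ∘ suc) g h n) ⟩
           f 0 * ((g ∘ suc) ⊛ h) n + ((f ∘ suc) ⊛ (g ⊛ h)) n ∎) ⟩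
    f 0 * (g 0 * h (suc n)) + (f 0 * ((g ∘ suc) ⊛ h) n + ((f ∘ suc) ⊛ (g ⊛ h)) n)
      ≈⟨ +-assoc _ _ _ ⟨
    f 0 * (g 0 * h (suc n)) + f 0 * ((g ∘ suc) ⊛ h) n + ((f ∘ suc) ⊛ (g ⊛ h)) n
      ≈⟨ +-congʳ (distribˡ _ _ _) ⟨
    f 0 * (g 0 * h (suc n) + ((g ∘ suc) ⊛ h) n) + ((f ∘ suc) ⊛ (g ⊛ h)) n ∎

  unit : ℕ → Carrier
  unit zero    = 1#
  unit (suc _) = 0#

  ⊛-zeroˡ : ∀ f → (λ _ → 0#) ⊛ f ≋ (λ _ → 0#)
  ⊛-zeroˡ f zero    = trans (+-identityʳ _) (zeroˡ _)
  ⊛-zeroˡ f (suc n) = trans (+-cong (zeroˡ _) (⊛-zeroˡ f n)) (+-identityʳ _)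

  ⊛-identityˡ : ∀ f → unit ⊛ f ≋ f
  ⊛-identityˡ f zero    = trans (+-identityʳ _) (*-identityˡ _)
  ⊛-identityˡ f (suc n) =
    trans (+-cong (*-identityˡ _) (⊛-zeroˡ f n)) (+-identityʳ _)

  commutativeRing : CommutativeRing c ℓ
  commutativeRing = record
    { Carrier = ℕ → Carrier
    ; _≈_     = _≋_
    ; _+_     = λ f g n → f n + g n
    ; _*_     = _⊛_
    ; -_      = λ f n → - f n
    ; 0#      = λ _ → 0#
    ; 1#      = unit
    ; isCommutativeRing = record
      { isRing = record
        { +-isAbelianGroup = record
          { isGroup = record
            { isMonoid = record
              { isSemigroup = record
                { isMagma = record
                  { isEquivalence = record
                    { refl  = λ _ → refl
                    ; sym   = λ p n → sym (p n)
                    ; trans = λ p r n → trans (p n) (r n)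
                    }
                  ; ∙-cong = λ p r n → +-cong (p n) (r n)
                  }
                ; assoc = λ f g h n → +-assoc (f n) (g n) (h n)
                }
              ; identity = (λ f n → +-identityˡ (f n)) , (λ f n → +-identityʳ (f n))
              }
            ; inverse = (λ f n → -‿inverseˡ (f n)) , (λ f n → -‿inverseʳ (f n))
            ; ⁻¹-cong = λ p n → -‿cong (p n)
            }
          ; comm = λ f g n → +-comm (f n) (g n)
          }
        ; *-cong     = ⊛-cong
        ; *-assoc    = ⊛-assoc
        ; *-identity = ⊛-identityˡ , λ f n → trans (⊛-comm f unit n) (⊛-identityˡ f n)
        ; distrib    =
            (λ h f g n → trans (⊛-comm h (λ i → f i + g i) n) (trans (⊛-distribʳ h f g n)
                           (+-cong (⊛-comm f h n) (⊛-comm g h n))))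
          , ⊛-distribʳ
        }
      ; *-comm = ⊛-comm
      }
    }

-- Contiguous relations of the triple sum

quadraticForm : ℕ → ℕ → ℕ → ℕ
quadraticForm i j k =
  3 ℕ.* (i C 2) ℕ.+ (j C 2) ℕ.+ (k C 2) ℕ.+ i ℕ.* j ℕ.+ j ℕ.* k ℕ.+ k ℕ.* i

sucC2 : ∀ n → suc n C 2 ≡ n ℕ.+ n C 2
sucC2 n = ≡.trans (≡.sym (nCk+nC[k+1]≡[n+1]C[k+1] n 1))
                  (≡.cong (ℕ._+ n C 2) (nC1≡n n))

module _ where
  open +-*-Solver

  quadraticForm-suc₁ : ∀ i j k → quadraticForm (suc i) j k ≡
    (i ℕ.+ i ℕ.+ i ℕ.+ j ℕ.+ k) ℕ.+ quadraticForm i j k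
  quadraticForm-suc₁ i j k rewrite sucC2 i =
    solve 6 (λ i j k x z w →
      con 3 :* (i :+ x) :+ z :+ w :+ (con 1 :+ i) :* j :+ j :* k :+ k :* (con 1 :+ i) :=
      (i :+ i :+ i :+ j :+ k) :+ (con 3 :* x :+ z :+ w :+ i :* j :+ j :* k :+ k :* i))
      ≡.refl i j k (i C 2) (j C 2) (k C 2)

  quadraticForm-suc₂ : ∀ i j k → quadraticForm i (suc j) k ≡
    (i ℕ.+ j ℕ.+ k) ℕ.+ quadraticForm i j k
  quadraticForm-suc₂ i j k rewrite sucC2 j =
    solve 6 (λ i j k x z w →
      con 3 :* x :+ (j :+ z) :+ w :+ i :* (con 1 :+ j) :+ (con 1 :+ j) :* k :+ k :* i :=
      (i :+ j :+ k) :+ (con 3 :* x :+ z :+ w :+ i :* j :+ j :* k :+ k :* i))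
      ≡.refl i j k (i C 2) (j C 2) (k C 2)

  quadraticForm-suc₃ : ∀ i j k → quadraticForm i j (suc k) ≡
    (i ℕ.+ j ℕ.+ k) ℕ.+ quadraticForm i j k
  quadraticForm-suc₃ i j k rewrite sucC2 k =
    solve 6 (λ i j k x z w →
      con 3 :* x :+ z :+ (k :+ w) :+ i :* j :+ j :* (con 1 :+ k) :+ (con 1 :+ k) :* i :=
      (i :+ j :+ k) :+ (con 3 :* x :+ z :+ w :+ i :* j :+ j :* k :+ k :* i))
      ≡.refl i j k (i C 2) (j C 2) (k C 2)

-- `Order k a` will mean that `a` has y-degree at least `k`. Sums will be cut at a length depending
-- on the coefficient, so growing order is demanded where a product mixes degrees or the index is
-- shifted.
record Summation (A : CommutativeRing 0ℓ 0ℓ) : Set₁ where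
  open CommutativeRing A
  field
    Order        : ℕ → Carrier → Set
    Order-zero   : ∀ a → Order 0 a
    Order-weaken : ∀ {j k a} → j ≤ k → Order k a → Order j a
    Order-*      : ∀ {j k a b} → Order j a → Order k b → Order (j ℕ.+ k) (a * b)
    Σ∞           : (ℕ → Carrier) → Carrier
    Order-Σ∞     : ∀ {k f} → (∀ i → Order k (f i)) → Order k (Σ∞ f)
    Σ∞-cong      : ∀ {f g} → (∀ i → f i ≈ g i) → Σ∞ f ≈ Σ∞ g
    Σ∞-+         : ∀ f g → Σ∞ (λ i → f i + g i) ≈ Σ∞ f + Σ∞ g
    Σ∞-*         : ∀ c f → (∀ i → Order i (f i)) → Σ∞ (λ i → c * f i) ≈ c * Σ∞ f
    Σ∞-suc       : ∀ f → (∀ i → Order i (f i)) → Σ∞ f ≈ f 0 + Σ∞ (f ∘ suc)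

-- num n = (-q;q)ₙ and den n = (q²;q²)ₙ, with the recurrence of den moved so
-- that no subtraction occurs.
record Factors (A : CommutativeRing 0ℓ 0ℓ) : Set where
  open CommutativeRing A
  open Exp semiring using (_^_)
  field
    q       : Carrier
    num den : ℕ → Carrier
    den⁻¹   : ℕ → ℕ → ℕ → Carrier
    num-suc : ∀ n → num (suc n) ≈ num n * (1# + q * q ^ n)
    den-suc : ∀ n → den (suc n) + den n * (q * q ^ n * (q * q ^ n)) ≈ den n
    den⁻¹-inverse : ∀ i j k → den⁻¹ i j k * (den i * den j * den k) ≈ 1#

module Coefficients (A : CommutativeRing 0ℓ 0ℓ) (Φ : Factors A) where
  open CommutativeRing A
  open Factors Φ
  open import Algebra.Properties.CommutativeSemiring.Exp commutativeSemiring
  open import Algebra.Solver.Ring.NaturalCoefficients.Default commutativeSemiring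
    using (solve; _:=_; _:+_; _:*_; con)
  open import Relation.Binary.Reasoning.Setoid setoid

  -- `E` is the summand of T without its weights. In `V` the numerator is one factor short, so `V`
  -- with one index raised has the same numerator as `E` before raising. At (0,0,0) `ℕ.pred` makes
  -- the two coincide.
  E V : ℕ → ℕ → ℕ → Carrier
  E i j k = q ^ quadraticForm i j k * (num (i ℕ.+ j ℕ.+ k) * den⁻¹ i j k)
  V i j k = q ^ quadraticForm i j k * (num (ℕ.pred (i ℕ.+ j ℕ.+ k)) * den⁻¹ i j k)

  q[_] : ℕ → Carrier
  q[ i ] = q ^ i

  -- Here w = 1/(ds), w′ = 1/(d′s) and d′ = d(1 - e), so the claim is w = (1 - e) w′. Multiplying by
  -- the known inverses replaces any cancellation.
  inverse-step : ∀ {w w′ d d′ s e} → w * (d * s) ≈ 1# → w′ * (d′ * s) ≈ 1# →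
                 d′ + d * e ≈ d → w′ ≈ e * w′ + w
  inverse-step {w} {w′} {d} {d′} {s} {e} wd≈1 w′d′≈1 d′+de≈d = begin
    w′                                        ≈⟨ *-identityʳ w′ ⟨
    w′ * 1#                                   ≈⟨ *-congˡ wd≈1 ⟨
    w′ * (w * (d * s))                        ≈⟨ *-congˡ (*-congˡ (*-congʳ d′+de≈d)) ⟨
    w′ * (w * ((d′ + d * e) * s))
      ≈⟨ solve 6 (λ w w′ d d′ s e → w′ :* (w :* ((d′ :+ d :* e) :* s)) :=
           e :* w′ :* (w :* (d :* s)) :+ w :* (w′ :* (d′ :* s))) refl w w′ d d′ s e ⟩
    e * w′ * (w * (d * s)) + w * (w′ * (d′ * s))
      ≈⟨ +-cong (*-congˡ wd≈1) (*-congˡ w′d′≈1) ⟩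
    e * w′ * 1# + w * 1#                      ≈⟨ +-cong (*-identityʳ _) (*-identityʳ _) ⟩
    e * w′ + w                                ∎

  V-step : ∀ {N p p′ m w w′ e r} → w′ ≈ e * w′ + w → p′ ≈ r * p → N ≈ m →
           p′ * (m * w′) ≈ e * (p′ * (m * w′)) + r * (p * (N * w))
  V-step {N} {p} {p′} {m} {w} {w′} {e} {r} w′≈ p′≈ N≈ = begin
    p′ * (m * w′)                  ≈⟨ *-congˡ (*-congˡ w′≈) ⟩
    p′ * (m * (e * w′ + w))
      ≈⟨ solve 5 (λ p m e w′ w → p :* (m :* (e :* w′ :+ w)) :=
           e :* (p :* (m :* w′)) :+ p :* (m :* w)) refl _ m e w′ w ⟩
    e * (p′ * (m * w′)) + p′ * (m * w)
      ≈⟨ +-congˡ (*-cong p′≈ (*-congʳ (sym N≈))) ⟩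
    e * (p′ * (m * w′)) + r * p * (N * w)
      ≈⟨ +-congˡ (*-assoc _ _ _) ⟩
    e * (p′ * (m * w′)) + r * (p * (N * w)) ∎

  square : ℕ → Carrier
  square i = q * q[ i ] * (q * q[ i ])

  -- `square i` is q^(2i+2), from the factor new in the denominator. The power q^(3i+j+k) is the
  -- growth of the quadratic form, whose coefficient 3 singles out the first index.
  V-suc₁ : ∀ i j k → V (suc i) j k ≈
    square i * V (suc i) j k + q[ i ] * q[ i ] * q[ i ] * q[ j ] * q[ k ] * E i j k
  V-suc₁ i j k = V-step
    (inverse-step (trans (*-congˡ (sym (*-assoc _ _ _))) (den⁻¹-inverse i j k))
                  (trans (*-congˡ (sym (*-assoc _ _ _))) (den⁻¹-inverse (suc i) j k))
                  (den-suc i))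
    (begin
      q ^ quadraticForm (suc i) j k   ≈⟨ ^-congʳ q (quadraticForm-suc₁ i j k) ⟩
      q ^ ((i ℕ.+ i ℕ.+ i ℕ.+ j ℕ.+ k) ℕ.+ quadraticForm i j k) ≈⟨ ^-homo-* q (i ℕ.+ i ℕ.+ i ℕ.+ j ℕ.+ k) (quadraticForm i j k) ⟩
      _ ≈⟨ *-congʳ (trans (^-homo-* q (i ℕ.+ i ℕ.+ i ℕ.+ j) k)
             (*-congʳ (trans (^-homo-* q (i ℕ.+ i ℕ.+ i) j)
             (*-congʳ (trans (^-homo-* q (i ℕ.+ i) i)
             (*-congʳ (^-homo-* q i i))))))) ⟩
      q[ i ] * q[ i ] * q[ i ] * q[ j ] * q[ k ] * q ^ quadraticForm i j k ∎)
    refl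

  private
    rotate₂ : ∀ w x z s → w * (x * z * s) ≈ w * (z * (x * s))
    rotate₂ = solve 4 (λ w x z s → w :* (x :* z :* s) := w :* (z :* (x :* s))) refl

    rotate₃ : ∀ w x z s → w * (x * z * s) ≈ w * (s * (x * z))
    rotate₃ = solve 4 (λ w x z s → w :* (x :* z :* s) := w :* (s :* (x :* z))) refl

  q^[i+j+k] : ∀ i j k → q ^ (i ℕ.+ j ℕ.+ k) ≈ q[ i ] * q[ j ] * q[ k ]
  q^[i+j+k] i j k = trans (^-homo-* q (i ℕ.+ j) k) (*-congʳ (^-homo-* q i j))

  V-suc₂ : ∀ i j k → V i (suc j) k ≈
    square j * V i (suc j) k + q[ i ] * q[ j ] * q[ k ] * E i j k
  V-suc₂ i j k = V-step
    (inverse-step (trans (sym (rotate₂ _ _ _ _)) (den⁻¹-inverse i j k))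
                  (trans (sym (rotate₂ _ _ _ _)) (den⁻¹-inverse i (suc j) k))
                  (den-suc j))
    (trans (^-congʳ q (quadraticForm-suc₂ i j k))
      (trans (^-homo-* q (i ℕ.+ j ℕ.+ k) (quadraticForm i j k)) (*-congʳ (q^[i+j+k] i j k))))
    (reflexive (≡.cong (num ∘ ℕ.pred ∘ (ℕ._+ k)) (≡.sym (ℕ.+-suc i j))))

  V-suc₃ : ∀ i j k → V i j (suc k) ≈
    square k * V i j (suc k) + q[ i ] * q[ j ] * q[ k ] * E i j k
  V-suc₃ i j k = V-step
    (inverse-step (trans (sym (rotate₃ _ _ _ _)) (den⁻¹-inverse i j k))
                  (trans (sym (rotate₃ _ _ _ _)) (den⁻¹-inverse i j (suc k)))
                  (den-suc k))
    (trans (^-congʳ q (quadraticForm-suc₃ i j k))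
      (trans (^-homo-* q (i ℕ.+ j ℕ.+ k) (quadraticForm i j k)) (*-congʳ (q^[i+j+k] i j k))))
    (reflexive (≡.cong (num ∘ ℕ.pred) (≡.sym (ℕ.+-suc (i ℕ.+ j) k))))

  E-from-V : ∀ {n} i j k → i ℕ.+ j ℕ.+ k ≡ suc n →
             E i j k ≈ (1# + q * q ^ n) * V i j k
  E-from-V {n} i j k eq rewrite eq = begin
    q ^ quadraticForm i j k * (num (suc n) * den⁻¹ i j k)
      ≈⟨ *-congˡ (*-congʳ (num-suc n)) ⟩
    q ^ quadraticForm i j k * (num n * (1# + q * q ^ n) * den⁻¹ i j k)
      ≈⟨ solve 4 (λ p m u w → p :* (m :* u :* w) := u :* (p :* (m :* w))) refl _ _ _ _ ⟩
    (1# + q * q ^ n) * (q ^ quadraticForm i j k * (num n * den⁻¹ i j k)) ∎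

  -- Raising any index lengthens the numerator by 1 + q^(i+j+k+1). Attached to the lower summand,
  -- this factor becomes the two-term bracket of the contiguous relations.
  E′ : ℕ → ℕ → ℕ → Carrier
  E′ i j k = (1# + q * (q[ i ] * q[ j ] * q[ k ])) * E i j k

  E-step : ∀ {n e r} i j k i′ j′ k′ → i ℕ.+ j ℕ.+ k ≡ suc (i′ ℕ.+ j′ ℕ.+ k′) →
           V i j k ≈ e * V i j k + r * n →
           E i j k ≈ e * E i j k + r * ((1# + q * (q[ i′ ] * q[ j′ ] * q[ k′ ])) * n)
  E-step {n} {e} {r} i j k i′ j′ k′ eq V≈ = begin
    E i j k                               ≈⟨ E≈ ⟩
    u * V i j k                           ≈⟨ *-congˡ V≈ ⟩
    u * (e * V i j k + r * n)
      ≈⟨ solve 5 (λ u e v r n → u :* (e :* v :+ r :* n) := e :* (u :* v) :+ r :* (u :* n))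
           refl u e _ r n ⟩
    e * (u * V i j k) + r * (u * n)       ≈⟨ +-congʳ (*-congˡ E≈) ⟨
    e * E i j k + r * (u * n)             ∎
    where
    u = 1# + q * (q[ i′ ] * q[ j′ ] * q[ k′ ])
    E≈ : E i j k ≈ u * V i j k
    E≈ = trans (E-from-V i j k eq) (*-congʳ (+-congˡ (*-congˡ (q^[i+j+k] i′ j′ k′))))

  E-suc₁ : ∀ i j k → E (suc i) j k ≈
    square i * E (suc i) j k + q[ i ] * q[ i ] * q[ i ] * q[ j ] * q[ k ] * E′ i j k
  E-suc₁ i j k = E-step (suc i) j k i j k ≡.refl (V-suc₁ i j k)

  E-suc₂ : ∀ i j k → E i (suc j) k ≈
    square j * E i (suc j) k + q[ i ] * q[ j ] * q[ k ] * E′ i j k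
  E-suc₂ i j k = E-step i (suc j) k i j k (≡.cong (ℕ._+ k) (ℕ.+-suc i j)) (V-suc₂ i j k)

  E-suc₃ : ∀ i j k → E i j (suc k) ≈
    square k * E i j (suc k) + q[ i ] * q[ j ] * q[ k ] * E′ i j k
  E-suc₃ i j k = E-step i j (suc k) i j k (ℕ.+-suc (i ℕ.+ j) k) (V-suc₃ i j k)

  -- (1 - q^{i+j+k}) E = (1 - q^{2(i+j+k)}) V: for i + j + k > 0 because
  -- E = (1 + q^{i+j+k}) V, for i = j = k = 0 because both sides vanish.
  E-V : ∀ i j k → let t = q[ i ] * q[ j ] * q[ k ] in
        E i j k + t * t * V i j k ≈ t * E i j k + V i j k
  E-V i j k = by-cases (i ℕ.+ j ℕ.+ k) ≡.refl
    where
    t e v : Carrier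
    t = q[ i ] * q[ j ] * q[ k ]
    e = E i j k
    v = V i j k

    by-cases : ∀ n → i ℕ.+ j ℕ.+ k ≡ n → e + t * t * v ≈ t * e + v
    by-cases zero eq = begin
      e + t * t * v      ≈⟨ +-cong e≈v (*-congʳ (*-cong t≈1 t≈1)) ⟩
      v + 1# * 1# * v    ≈⟨ +-congˡ (*-congʳ (*-identityˡ 1#)) ⟩
      v + 1# * v         ≈⟨ +-comm _ _ ⟩
      1# * v + v         ≈⟨ +-congʳ (*-cong t≈1 e≈v) ⟨
      t * e + v          ∎
      where
      t≈1 : t ≈ 1#
      t≈1 = trans (sym (q^[i+j+k] i j k)) (^-congʳ q eq)
      e≈v : e ≈ v
      e≈v = *-congˡ (*-congʳ (reflexive (≡.cong num
              (≡.trans eq (≡.cong ℕ.pred (≡.sym eq))))))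
    by-cases (suc n) eq = begin
      e + t * t * v                    ≈⟨ +-congʳ e≈ ⟩
      (1# + t) * v + t * t * v
        ≈⟨ solve 2 (λ t v → (con 1 :+ t) :* v :+ t :* t :* v := t :* ((con 1 :+ t) :* v) :+ v)
             refl t v ⟩
      t * ((1# + t) * v) + v           ≈⟨ +-congʳ (*-congˡ e≈) ⟨
      t * e + v                        ∎
      where
      e≈ : e ≈ (1# + t) * v
      e≈ = trans (E-from-V i j k eq)
             (*-congʳ (+-congˡ (trans (sym (^-congʳ q eq)) (q^[i+j+k] i j k))))

-- Triple sums and recurrences along one index

module TripleSums (A : CommutativeRing 0ℓ 0ℓ) (Σ : Summation A) where
  open CommutativeRing A
  open Summation Σ
  open import Relation.Binary.Reasoning.Setoid setoid

  Family : Set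
  Family = ℕ → ℕ → ℕ → Carrier

  Σ² : (ℕ → ℕ → Carrier) → Carrier
  Σ² f = Σ∞ λ j → Σ∞ λ k → f j k

  Σ³ : Family → Carrier
  Σ³ f = Σ∞ λ i → Σ² (f i)

  Summable¹ : (ℕ → Carrier) → Set
  Summable¹ f = ∀ i → Order i (f i)

  Summable³ : Family → Set
  Summable³ f = ∀ i j k → Order (i ℕ.+ j ℕ.+ k) (f i j k)

  Summable₁ : ∀ {f} → Summable³ f → Summable¹ (λ i → Σ² (f i))
  Summable₁ o i = Order-Σ∞ λ j → Order-Σ∞ λ k →
    Order-weaken (ℕ.≤-trans (ℕ.m≤m+n i j) (ℕ.m≤m+n (i ℕ.+ j) k)) (o i j k)

  Summable₂ : ∀ {f} → Summable³ f → ∀ i → Summable¹ (λ j → Σ∞ (f i j))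
  Summable₂ o i j = Order-Σ∞ λ k →
    Order-weaken (ℕ.≤-trans (ℕ.m≤n+m j i) (ℕ.m≤m+n (i ℕ.+ j) k)) (o i j k)

  Summable₃ : ∀ {f} → Summable³ f → ∀ i j → Summable¹ (f i j)
  Summable₃ o i j k = Order-weaken (ℕ.m≤n+m k (i ℕ.+ j)) (o i j k)

  Σ-linear : ∀ {f g h} c → Summable¹ h → (∀ i → f i ≈ g i + c * h i) →
             Σ∞ f ≈ Σ∞ g + c * Σ∞ h
  Σ-linear {f} {g} {h} c vh eq = begin
    Σ∞ f                             ≈⟨ Σ∞-cong eq ⟩
    Σ∞ (λ i → g i + c * h i)         ≈⟨ Σ∞-+ g (λ i → c * h i) ⟩
    Σ∞ g + Σ∞ (λ i → c * h i)        ≈⟨ +-congˡ (Σ∞-* c h vh) ⟩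
    Σ∞ g + c * Σ∞ h                  ∎

  -- The recurrences lead from index i + 1 to index i, so the sum of `h` starts at 0 although it
  -- corrects only the terms of `f` from 1 on.
  Σ-peel : ∀ {f g h} c → Summable¹ f → Summable¹ g → Summable¹ h →
           f 0 ≈ g 0 → (∀ i → f (suc i) ≈ g (suc i) + c * h i) →
           Σ∞ f ≈ Σ∞ g + c * Σ∞ h
  Σ-peel {f} {g} {h} c vf vg vh eq₀ eq = begin
    Σ∞ f                                 ≈⟨ Σ∞-suc f vf ⟩
    f 0 + Σ∞ (f ∘ suc)                   ≈⟨ +-cong eq₀ (Σ-linear c vh eq) ⟩
    g 0 + (Σ∞ (g ∘ suc) + c * Σ∞ h)      ≈⟨ +-assoc _ _ _ ⟨
    g 0 + Σ∞ (g ∘ suc) + c * Σ∞ h        ≈⟨ +-congʳ (Σ∞-suc g vg) ⟨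
    Σ∞ g + c * Σ∞ h                      ∎

  Σ³-cong : ∀ {f g : Family} → (∀ i j k → f i j k ≈ g i j k) → Σ³ f ≈ Σ³ g
  Σ³-cong eq = Σ∞-cong λ i → Σ∞-cong λ j → Σ∞-cong λ k → eq i j k

  Σ³-linear : ∀ {f g h : Family} c → Summable³ h →
              (∀ i j k → f i j k ≈ g i j k + c * h i j k) → Σ³ f ≈ Σ³ g + c * Σ³ h
  Σ³-linear c vh eq = Σ-linear c (Summable₁ vh) λ i → Σ-linear c (Summable₂ vh i) λ j →
    Σ-linear c (Summable₃ vh i j) (eq i j)

  module _ {f g h : Family} (c : Carrier)
           (vf : Summable³ f) (vg : Summable³ g) (vh : Summable³ h) where

    Σ³-peel₁ : (∀ j k → f 0 j k ≈ g 0 j k) →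
               (∀ i j k → f (suc i) j k ≈ g (suc i) j k + c * h i j k) →
               Σ³ f ≈ Σ³ g + c * Σ³ h
    Σ³-peel₁ eq₀ eq = Σ-peel c (Summable₁ vf) (Summable₁ vg) (Summable₁ vh)
      (Σ∞-cong λ j → Σ∞-cong λ k → eq₀ j k)
      λ i → Σ-linear c (Summable₂ vh i) λ j → Σ-linear c (Summable₃ vh i j) (eq i j)

    Σ³-peel₂ : (∀ i k → f i 0 k ≈ g i 0 k) →
               (∀ i j k → f i (suc j) k ≈ g i (suc j) k + c * h i j k) →
               Σ³ f ≈ Σ³ g + c * Σ³ h
    Σ³-peel₂ eq₀ eq = Σ-linear c (Summable₁ vh) λ i →
      Σ-peel c (Summable₂ vf i) (Summable₂ vg i) (Summable₂ vh i)
        (Σ∞-cong λ k → eq₀ i k)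
        λ j → Σ-linear c (Summable₃ vh i j) (eq i j)

    Σ³-peel₃ : (∀ i j → f i j 0 ≈ g i j 0) →
               (∀ i j k → f i j (suc k) ≈ g i j (suc k) + c * h i j k) →
               Σ³ f ≈ Σ³ g + c * Σ³ h
    Σ³-peel₃ eq₀ eq = Σ-linear c (Summable₁ vh) λ i → Σ-linear c (Summable₂ vh i) λ j →
      Σ-peel c (Summable₃ vf i j) (Summable₃ vg i j) (Summable₃ vh i j) (eq₀ i j) (eq i j)

-- Contiguous relations and transfer equations

module Contiguity (A : CommutativeRing 0ℓ 0ℓ) (Σ : Summation A) (Φ : Factors A) where
  open CommutativeRing A
  open Summation Σ
  open Factors Φ
  open TripleSums A Σ
  open Coefficients A Φ
  open import Algebra.Properties.CommutativeSemiring.Exp commutativeSemiring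
  open import Algebra.Properties.AbelianGroup +-abelianGroup using (∙-cancelʳ)
  open import Algebra.Solver.Ring.NaturalCoefficients.Default commutativeSemiring
    using (solve; _:=_; _:+_; _:*_; con)
  open import Relation.Binary.Reasoning.Setoid setoid

  Order-^ : ∀ {a} → Order 1 a → ∀ n → Order n (a ^ n)
  Order-^ o zero    = Order-zero _
  Order-^ o (suc n) = Order-* o (Order-^ o n)

  Order-*ˡ : ∀ {n a} b → Order n a → Order n (b * a)
  Order-*ˡ b = Order-* (Order-zero b)

  monomial : Carrier → Carrier → Carrier → Family
  monomial a b c i j k = a ^ i * b ^ j * c ^ k

  monomial-cong : ∀ {a a′ b b′ c c′} → a ≈ a′ → b ≈ b′ → c ≈ c′ →
                  ∀ i j k → monomial a b c i j k ≈ monomial a′ b′ c′ i j k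
  monomial-cong p r s i j k = *-cong (*-cong (^-congˡ i p) (^-congˡ j r)) (^-congˡ k s)

  powers : ℕ → ℕ → ℕ → Family
  powers α β γ i j k = q[ i ] ^ α * q[ j ] ^ β * q[ k ] ^ γ

  q^-comm : ∀ m n → (q ^ m) ^ n ≈ (q ^ n) ^ m
  q^-comm m n = begin
    (q ^ m) ^ n    ≈⟨ ^-assocʳ q m n ⟩
    q ^ (m ℕ.* n)  ≈⟨ ^-congʳ q (ℕ.*-comm m n) ⟩
    q ^ (n ℕ.* m)  ≈⟨ ^-assocʳ q n m ⟨
    (q ^ n) ^ m    ∎

  monomial-shift : ∀ a b c α β γ i j k →
    monomial (a * q ^ α) (b * q ^ β) (c * q ^ γ) i j k ≈ powers α β γ i j k * monomial a b c i j k
  monomial-shift a b c α β γ i j k = begin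
    (a * q ^ α) ^ i * (b * q ^ β) ^ j * (c * q ^ γ) ^ k
      ≈⟨ *-cong (*-cong (split a α i) (split b β j)) (split c γ k) ⟩
    a ^ i * q[ i ] ^ α * (b ^ j * q[ j ] ^ β) * (c ^ k * q[ k ] ^ γ)
      ≈⟨ solve 6 (λ a b c x z w → a :* x :* (b :* z) :* (c :* w) :=
           x :* z :* w :* (a :* b :* c)) refl _ _ _ _ _ _ ⟩
    powers α β γ i j k * monomial a b c i j k ∎
    where
    split : ∀ a α i → (a * q ^ α) ^ i ≈ a ^ i * q[ i ] ^ α
    split a α i = trans (^-distrib-* a (q ^ α) i) (*-congˡ (q^-comm α i))

  term : Family → ℕ → ℕ → ℕ → Carrier → Carrier → Carrier → Family
  term F α β γ a b c i j k = F i j k * powers α β γ i j k * monomial a b c i j k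

  -- sum E α β γ a b c is T(a q^α, b q^β, c q^γ).
  sum : Family → ℕ → ℕ → ℕ → Carrier → Carrier → Carrier → Carrier
  sum F α β γ a b c = Σ³ (term F α β γ a b c)

  term-literal : ∀ {a b c a′ b′ c′} α β γ → a′ ≈ a * q ^ α → b′ ≈ b * q ^ β → c′ ≈ c * q ^ γ →
    ∀ i j k → q ^ quadraticForm i j k *
                ((a′ ^ i * b′ ^ j * c′ ^ k * num (i ℕ.+ j ℕ.+ k)) * den⁻¹ i j k) ≈
              term E α β γ a b c i j k
  term-literal {a} {b} {c} α β γ p r s i j k = begin
    _ ≈⟨ *-congˡ (*-congʳ (*-congʳ (trans (monomial-cong p r s i j k)
                                          (monomial-shift a b c α β γ i j k)))) ⟩
    _ ≈⟨ solve 5 (λ Q P M n w → Q :* (P :* M :* n :* w) := Q :* (n :* w) :* P :* M)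
           refl (q ^ quadraticForm i j k) (powers α β γ i j k) (monomial a b c i j k)
           (num (i ℕ.+ j ℕ.+ k)) (den⁻¹ i j k) ⟩
    term E α β γ a b c i j k ∎

  1^ : ∀ n → 1# ^ n ≈ 1#
  1^ zero    = refl
  1^ (suc n) = trans (*-identityˡ (1# ^ n)) (1^ n)

  term-000 : num 0 ≈ 1# → ∀ a b c α β γ → term E α β γ a b c 0 0 0 ≈ den⁻¹ 0 0 0
  term-000 num-zero a b c α β γ = begin
    1# * (num 0 * den⁻¹ 0 0 0) * (1# ^ α * 1# ^ β * 1# ^ γ) * (1# * 1# * 1#)
      ≈⟨ *-congʳ (*-cong (*-congˡ (*-congʳ num-zero)) (*-cong (*-cong (1^ α) (1^ β)) (1^ γ))) ⟩
    1# * (1# * den⁻¹ 0 0 0) * (1# * 1# * 1#) * (1# * 1# * 1#)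
      ≈⟨ solve 1 (λ r → con 1 :* (con 1 :* r) :* (con 1 :* con 1 :* con 1)
                          :* (con 1 :* con 1 :* con 1) := r) refl (den⁻¹ 0 0 0) ⟩
    den⁻¹ 0 0 0 ∎

  module _ {a b c : Carrier} (oa : Order 1 a) (ob : Order 1 b) (oc : Order 1 c) where

    term-summable : ∀ F α β γ → Summable³ (term F α β γ a b c)
    term-summable F α β γ i j k = Order-*ˡ _
      (Order-* (Order-* (Order-^ oa i) (Order-^ ob j)) (Order-^ oc k))

    module _ {F G : Family} (α β γ : ℕ) where

      -- Powers of q become shifts of the weights: q^(2i+2) raises `α` by two, q^(3i+j+k) shifts the
      -- lowered summand by (3,1,1), and lowering the index releases one factor a q^α. At i = 0 the
      -- shift by two is invisible.
      sum-suc₁ :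
        (∀ i j k → F (suc i) j k ≈ square i * F (suc i) j k +
           q[ i ] * q[ i ] * q[ i ] * q[ j ] * q[ k ] * G i j k) →
        sum F α β γ a b c ≈
        sum F (2 ℕ.+ α) β γ a b c + a * q ^ α * sum G (3 ℕ.+ α) (1 ℕ.+ β) (1 ℕ.+ γ) a b c
      sum-suc₁ rec = Σ³-peel₁ (a * q ^ α)
        (term-summable F α β γ) (term-summable F (2 ℕ.+ α) β γ)
        (term-summable G (3 ℕ.+ α) (1 ℕ.+ β) (1 ℕ.+ γ))
        (λ j k → *-congʳ (*-congˡ (*-congʳ (*-congʳ
          (sym (trans (*-identityˡ _) (*-identityˡ _)))))))
        λ i j k → begin
          F (suc i) j k * (q[ suc i ] ^ α * q[ j ] ^ β * q[ k ] ^ γ) * (a ^ suc i * b ^ j * c ^ k)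
            ≈⟨ *-congʳ (*-congʳ (rec i j k)) ⟩
          (square i * F (suc i) j k + q[ i ] * q[ i ] * q[ i ] * q[ j ] * q[ k ] * G i j k)
            * (q[ suc i ] ^ α * q[ j ] ^ β * q[ k ] ^ γ) * (a ^ suc i * b ^ j * c ^ k)
            ≈⟨ solve 13 (λ q x z w f g P Z W a A B C →
                 (q :* x :* (q :* x) :* f :+ x :* x :* x :* z :* w :* g)
                   :* (P :* Z :* W) :* (a :* A :* B :* C) :=
                 f :* (q :* x :* (q :* x :* P) :* Z :* W) :* (a :* A :* B :* C) :+
                 a :* P :* (g :* (x :* (x :* x) :* (z :* Z) :* (w :* W)) :* (A :* B :* C)))
                 refl q q[ i ] q[ j ] q[ k ] (F (suc i) j k) (G i j k)
                 (q[ suc i ] ^ α) (q[ j ] ^ β) (q[ k ] ^ γ) a (a ^ i) (b ^ j) (c ^ k) ⟩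
          term F (2 ℕ.+ α) β γ a b c (suc i) j k + a * q[ suc i ] ^ α *
            (G i j k * (q[ i ] * (q[ i ] * q[ i ]) * (q[ j ] * q[ j ] ^ β) * (q[ k ] * q[ k ] ^ γ))
               * monomial a b c i j k)
            ≈⟨ +-congˡ (*-congʳ (*-congˡ (^-distrib-* q q[ i ] α))) ⟩
          term F (2 ℕ.+ α) β γ a b c (suc i) j k + a * (q ^ α * q[ i ] ^ α) *
            (G i j k * (q[ i ] * (q[ i ] * q[ i ]) * (q[ j ] * q[ j ] ^ β) * (q[ k ] * q[ k ] ^ γ))
               * monomial a b c i j k)
            ≈⟨ +-congˡ (solve 8 (λ a Q X g x Z W M →
                 a :* (Q :* X) :* (g :* (x :* (x :* x) :* Z :* W) :* M) :=
                 a :* Q :* (g :* (x :* (x :* (x :* X)) :* Z :* W) :* M))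
                 refl a (q ^ α) (q[ i ] ^ α) (G i j k) q[ i ] (q[ j ] * q[ j ] ^ β)
                 (q[ k ] * q[ k ] ^ γ) (monomial a b c i j k)) ⟩
          term F (2 ℕ.+ α) β γ a b c (suc i) j k +
            a * q ^ α * term G (3 ℕ.+ α) (1 ℕ.+ β) (1 ℕ.+ γ) a b c i j k ∎

      sum-suc₂ :
        (∀ i j k → F i (suc j) k ≈ square j * F i (suc j) k +
           q[ i ] * q[ j ] * q[ k ] * G i j k) →
        sum F α β γ a b c ≈
        sum F α (2 ℕ.+ β) γ a b c + b * q ^ β * sum G (1 ℕ.+ α) (1 ℕ.+ β) (1 ℕ.+ γ) a b c
      sum-suc₂ rec = Σ³-peel₂ (b * q ^ β)
        (term-summable F α β γ) (term-summable F α (2 ℕ.+ β) γ)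
        (term-summable G (1 ℕ.+ α) (1 ℕ.+ β) (1 ℕ.+ γ))
        (λ i k → *-congʳ (*-congˡ (*-congʳ (*-congˡ
          (sym (trans (*-identityˡ _) (*-identityˡ _)))))))
        λ i j k → begin
          F i (suc j) k * (q[ i ] ^ α * q[ suc j ] ^ β * q[ k ] ^ γ) * (a ^ i * b ^ suc j * c ^ k)
            ≈⟨ *-congʳ (*-congʳ (rec i j k)) ⟩
          (square j * F i (suc j) k + q[ i ] * q[ j ] * q[ k ] * G i j k)
            * (q[ i ] ^ α * q[ suc j ] ^ β * q[ k ] ^ γ) * (a ^ i * b ^ suc j * c ^ k)
            ≈⟨ solve 13 (λ q x z w f g X P W b A B C →
                 (q :* z :* (q :* z) :* f :+ x :* z :* w :* g)
                   :* (X :* P :* W) :* (A :* (b :* B) :* C) :=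
                 f :* (X :* (q :* z :* (q :* z :* P)) :* W) :* (A :* (b :* B) :* C) :+
                 b :* P :* (g :* (x :* X :* z :* (w :* W)) :* (A :* B :* C)))
                 refl q q[ i ] q[ j ] q[ k ] (F i (suc j) k) (G i j k)
                 (q[ i ] ^ α) (q[ suc j ] ^ β) (q[ k ] ^ γ) b (a ^ i) (b ^ j) (c ^ k) ⟩
          term F α (2 ℕ.+ β) γ a b c i (suc j) k + b * q[ suc j ] ^ β *
            (G i j k * (q[ i ] * q[ i ] ^ α * q[ j ] * (q[ k ] * q[ k ] ^ γ)) * monomial a b c i j k)
            ≈⟨ +-congˡ (*-congʳ (*-congˡ (^-distrib-* q q[ j ] β))) ⟩
          term F α (2 ℕ.+ β) γ a b c i (suc j) k + b * (q ^ β * q[ j ] ^ β) *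
            (G i j k * (q[ i ] * q[ i ] ^ α * q[ j ] * (q[ k ] * q[ k ] ^ γ)) * monomial a b c i j k)
            ≈⟨ +-congˡ (solve 8 (λ b Q Z g z X W M →
                 b :* (Q :* Z) :* (g :* (X :* z :* W) :* M) :=
                 b :* Q :* (g :* (X :* (z :* Z) :* W) :* M))
                 refl b (q ^ β) (q[ j ] ^ β) (G i j k) q[ j ] (q[ i ] * q[ i ] ^ α)
                 (q[ k ] * q[ k ] ^ γ) (monomial a b c i j k)) ⟩
          term F α (2 ℕ.+ β) γ a b c i (suc j) k +
            b * q ^ β * term G (1 ℕ.+ α) (1 ℕ.+ β) (1 ℕ.+ γ) a b c i j k ∎

      sum-suc₃ :
        (∀ i j k → F i j (suc k) ≈ square k * F i j (suc k) +
           q[ i ] * q[ j ] * q[ k ] * G i j k) →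
        sum F α β γ a b c ≈
        sum F α β (2 ℕ.+ γ) a b c + c * q ^ γ * sum G (1 ℕ.+ α) (1 ℕ.+ β) (1 ℕ.+ γ) a b c
      sum-suc₃ rec = Σ³-peel₃ (c * q ^ γ)
        (term-summable F α β γ) (term-summable F α β (2 ℕ.+ γ))
        (term-summable G (1 ℕ.+ α) (1 ℕ.+ β) (1 ℕ.+ γ))
        (λ i j → *-congʳ (*-congˡ (*-congˡ
          (sym (trans (*-identityˡ _) (*-identityˡ _))))))
        λ i j k → begin
          F i j (suc k) * (q[ i ] ^ α * q[ j ] ^ β * q[ suc k ] ^ γ) * (a ^ i * b ^ j * c ^ suc k)
            ≈⟨ *-congʳ (*-congʳ (rec i j k)) ⟩
          (square k * F i j (suc k) + q[ i ] * q[ j ] * q[ k ] * G i j k)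
            * (q[ i ] ^ α * q[ j ] ^ β * q[ suc k ] ^ γ) * (a ^ i * b ^ j * c ^ suc k)
            ≈⟨ solve 13 (λ q x z w f g X Z P c A B C →
                 (q :* w :* (q :* w) :* f :+ x :* z :* w :* g)
                   :* (X :* Z :* P) :* (A :* B :* (c :* C)) :=
                 f :* (X :* Z :* (q :* w :* (q :* w :* P))) :* (A :* B :* (c :* C)) :+
                 c :* P :* (g :* (x :* X :* (z :* Z) :* w) :* (A :* B :* C)))
                 refl q q[ i ] q[ j ] q[ k ] (F i j (suc k)) (G i j k)
                 (q[ i ] ^ α) (q[ j ] ^ β) (q[ suc k ] ^ γ) c (a ^ i) (b ^ j) (c ^ k) ⟩
          term F α β (2 ℕ.+ γ) a b c i j (suc k) + c * q[ suc k ] ^ γ *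
            (G i j k * (q[ i ] * q[ i ] ^ α * (q[ j ] * q[ j ] ^ β) * q[ k ]) * monomial a b c i j k)
            ≈⟨ +-congˡ (*-congʳ (*-congˡ (^-distrib-* q q[ k ] γ))) ⟩
          term F α β (2 ℕ.+ γ) a b c i j (suc k) + c * (q ^ γ * q[ k ] ^ γ) *
            (G i j k * (q[ i ] * q[ i ] ^ α * (q[ j ] * q[ j ] ^ β) * q[ k ]) * monomial a b c i j k)
            ≈⟨ +-congˡ (solve 8 (λ c Q W g w X Z M →
                 c :* (Q :* W) :* (g :* (X :* Z :* w) :* M) :=
                 c :* Q :* (g :* (X :* Z :* (w :* W)) :* M))
                 refl c (q ^ γ) (q[ k ] ^ γ) (G i j k) q[ k ] (q[ i ] * q[ i ] ^ α)
                 (q[ j ] * q[ j ] ^ β) (monomial a b c i j k)) ⟩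
          term F α β (2 ℕ.+ γ) a b c i j (suc k) +
            c * q ^ γ * term G (1 ℕ.+ α) (1 ℕ.+ β) (1 ℕ.+ γ) a b c i j k ∎

    T U : ℕ → ℕ → ℕ → Carrier
    T α β γ = sum E α β γ a b c
    U α β γ = sum V α β γ a b c

    sum-E′ : ∀ α β γ → sum E′ α β γ a b c ≈ T α β γ + q * T (1 ℕ.+ α) (1 ℕ.+ β) (1 ℕ.+ γ)
    sum-E′ α β γ = Σ³-linear q (term-summable E (1 ℕ.+ α) (1 ℕ.+ β) (1 ℕ.+ γ)) λ i j k →
      solve 9 (λ q x z w e X Z W M →
        (con 1 :+ q :* (x :* z :* w)) :* e :* (X :* Z :* W) :* M :=
        e :* (X :* Z :* W) :* M :+ q :* (e :* (x :* X :* (z :* Z) :* (w :* W)) :* M))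
        refl q q[ i ] q[ j ] q[ k ] (E i j k) (q[ i ] ^ α) (q[ j ] ^ β) (q[ k ] ^ γ)
        (monomial a b c i j k)

    T-contiguous₁ : ∀ α β γ → T α β γ ≈ T (2 ℕ.+ α) β γ +
      a * q ^ α * (T (3 ℕ.+ α) (1 ℕ.+ β) (1 ℕ.+ γ) + q * T (4 ℕ.+ α) (2 ℕ.+ β) (2 ℕ.+ γ))
    T-contiguous₁ α β γ = trans (sum-suc₁ α β γ E-suc₁) (+-congˡ (*-congˡ (sum-E′ (3 ℕ.+ α) (1 ℕ.+ β) (1 ℕ.+ γ))))

    T-contiguous₂ : ∀ α β γ → T α β γ ≈ T α (2 ℕ.+ β) γ +
      b * q ^ β * (T (1 ℕ.+ α) (1 ℕ.+ β) (1 ℕ.+ γ) + q * T (2 ℕ.+ α) (2 ℕ.+ β) (2 ℕ.+ γ))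
    T-contiguous₂ α β γ = trans (sum-suc₂ α β γ E-suc₂) (+-congˡ (*-congˡ (sum-E′ (1 ℕ.+ α) (1 ℕ.+ β) (1 ℕ.+ γ))))

    T-contiguous₃ : ∀ α β γ → T α β γ ≈ T α β (2 ℕ.+ γ) +
      c * q ^ γ * (T (1 ℕ.+ α) (1 ℕ.+ β) (1 ℕ.+ γ) + q * T (2 ℕ.+ α) (2 ℕ.+ β) (2 ℕ.+ γ))
    T-contiguous₃ α β γ = trans (sum-suc₃ α β γ E-suc₃) (+-congˡ (*-congˡ (sum-E′ (1 ℕ.+ α) (1 ℕ.+ β) (1 ℕ.+ γ))))

    -- The summed form of (1 - q^N) E = (1 - q^(2N)) V with N = i+j+k: each factor q^N shifts all
    -- three exponents by one.
    T-U : ∀ α β γ → T α β γ + U (2 ℕ.+ α) (2 ℕ.+ β) (2 ℕ.+ γ) ≈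
                    T (1 ℕ.+ α) (1 ℕ.+ β) (1 ℕ.+ γ) + U α β γ
    T-U α β γ = begin
      T α β γ + U (2 ℕ.+ α) (2 ℕ.+ β) (2 ℕ.+ γ)
        ≈⟨ +-congˡ (*-identityˡ _) ⟨
      T α β γ + 1# * U (2 ℕ.+ α) (2 ℕ.+ β) (2 ℕ.+ γ)
        ≈⟨ Σ³-linear 1# (term-summable V (2 ℕ.+ α) (2 ℕ.+ β) (2 ℕ.+ γ)) (λ i j k → refl) ⟨
      Σ³ (λ i j k → term E α β γ a b c i j k +
                    1# * term V (2 ℕ.+ α) (2 ℕ.+ β) (2 ℕ.+ γ) a b c i j k)
        ≈⟨ Σ³-cong (λ i j k → recombine i j k (E-V i j k)) ⟩
      Σ³ (λ i j k → term E (1 ℕ.+ α) (1 ℕ.+ β) (1 ℕ.+ γ) a b c i j k +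
                    1# * term V α β γ a b c i j k)
        ≈⟨ Σ³-linear 1# (term-summable V α β γ) (λ i j k → refl) ⟩
      T (1 ℕ.+ α) (1 ℕ.+ β) (1 ℕ.+ γ) + 1# * U α β γ
        ≈⟨ +-congˡ (*-identityˡ _) ⟩
      T (1 ℕ.+ α) (1 ℕ.+ β) (1 ℕ.+ γ) + U α β γ ∎
      where
      recombine : ∀ i j k → let t = q[ i ] * q[ j ] * q[ k ] in
        E i j k + t * t * V i j k ≈ t * E i j k + V i j k →
        term E α β γ a b c i j k + 1# * term V (2 ℕ.+ α) (2 ℕ.+ β) (2 ℕ.+ γ) a b c i j k ≈
        term E (1 ℕ.+ α) (1 ℕ.+ β) (1 ℕ.+ γ) a b c i j k + 1# * term V α β γ a b c i j k
      recombine i j k eq = begin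
        _ ≈⟨ solve 9 (λ x z w e v X Z W M →
               e :* (X :* Z :* W) :* M :+
                 con 1 :* (v :* (x :* (x :* X) :* (z :* (z :* Z)) :* (w :* (w :* W))) :* M) :=
               (e :+ x :* z :* w :* (x :* z :* w) :* v) :* (X :* Z :* W :* M))
               refl q[ i ] q[ j ] q[ k ] (E i j k) (V i j k)
               (q[ i ] ^ α) (q[ j ] ^ β) (q[ k ] ^ γ) (monomial a b c i j k) ⟩
        _ ≈⟨ *-congʳ eq ⟩
        _ ≈⟨ solve 9 (λ x z w e v X Z W M →
               (x :* z :* w :* e :+ v) :* (X :* Z :* W :* M) :=
               e :* (x :* X :* (z :* Z) :* (w :* W)) :* M :+
                 con 1 :* (v :* (X :* Z :* W) :* M))
               refl q[ i ] q[ j ] q[ k ] (E i j k) (V i j k)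
               (q[ i ] ^ α) (q[ j ] ^ β) (q[ k ] ^ γ) (monomial a b c i j k) ⟩
        _ ∎

    -- The shift of `U` by (2,2,2) is performed one variable at a time. Taking `α` first offsets the
    -- exponent 3i of the first recurrence, so that the red and the green step leave the same series
    -- and share a coefficient. The fully shifted `U` then cancels.
    T-step : ∀ α β γ → T α β γ ≈ T (1 ℕ.+ α) (1 ℕ.+ β) (1 ℕ.+ γ) +
      ((a * q ^ α + b * q ^ β) * T (3 ℕ.+ α) (1 ℕ.+ β) (1 ℕ.+ γ) +
       c * q ^ γ * T (3 ℕ.+ α) (3 ℕ.+ β) (1 ℕ.+ γ))
    T-step α β γ = ∙-cancelʳ (U (2 ℕ.+ α) (2 ℕ.+ β) (2 ℕ.+ γ)) _ _ (begin
      T α β γ + u                       ≈⟨ T-U α β γ ⟩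
      t₁ + U α β γ                      ≈⟨ +-congˡ (sum-suc₁ α β γ V-suc₁) ⟩
      t₁ + (U (2 ℕ.+ α) β γ + a * q ^ α * t₂)
        ≈⟨ +-congˡ (+-congʳ (sum-suc₂ (2 ℕ.+ α) β γ V-suc₂)) ⟩
      t₁ + (U (2 ℕ.+ α) (2 ℕ.+ β) γ + b * q ^ β * t₂ + a * q ^ α * t₂)
        ≈⟨ +-congˡ (+-congʳ (+-congʳ (sum-suc₃ (2 ℕ.+ α) (2 ℕ.+ β) γ V-suc₃))) ⟩
      t₁ + (u + c * q ^ γ * t₃ + b * q ^ β * t₂ + a * q ^ α * t₂)
        ≈⟨ solve 7 (λ t₁ t₂ t₃ u a b c →
             t₁ :+ (u :+ c :* t₃ :+ b :* t₂ :+ a :* t₂) :=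
             t₁ :+ ((a :+ b) :* t₂ :+ c :* t₃) :+ u)
             refl t₁ t₂ t₃ u (a * q ^ α) (b * q ^ β) (c * q ^ γ) ⟩
      t₁ + ((a * q ^ α + b * q ^ β) * t₂ + c * q ^ γ * t₃) + u ∎)
      where
      t₁ t₂ t₃ u : Carrier
      t₁ = T (1 ℕ.+ α) (1 ℕ.+ β) (1 ℕ.+ γ)
      t₂ = T (3 ℕ.+ α) (1 ℕ.+ β) (1 ℕ.+ γ)
      t₃ = T (3 ℕ.+ α) (3 ℕ.+ β) (1 ℕ.+ γ)
      u  = U (2 ℕ.+ α) (2 ℕ.+ β) (2 ℕ.+ γ)

    -- The argument `n` is the next size to be decided: parts of that size weigh a q^n, b q^n and c
    -- q^n.
    ZG ZB X Y : ℕ → Carrier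
    ZG n = T (2 ℕ.+ n) n (1 ℕ.+ n)
    ZB n = T (1 ℕ.+ n) (1 ℕ.+ n) n
    Y n  = ZB n + b * q ^ n * ZG (suc n)
    X n  = Y n + a * q ^ n * ZG (suc n)

    -- In the bracket of the green relation, the first series is the continuation after a green part
    -- of size n. The second, with its extra q, is that after a green part of size n + 1, which
    -- completes `Y (suc n)`.
    ZG-step : ∀ n → ZG n ≈ Y (suc n) + b * q ^ n * ZG (suc n)
    ZG-step n = begin
      ZG n                                        ≈⟨ T-contiguous₂ (2 ℕ.+ n) n (1 ℕ.+ n) ⟩
      ZB (suc n) + b * q ^ n * (ZG (suc n) + q * ZG (suc (suc n)))
        ≈⟨ solve 6 (λ z b Q s q t → z :+ b :* Q :* (s :+ q :* t) :=
             z :+ b :* (q :* Q) :* t :+ b :* Q :* s)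
             refl (ZB (suc n)) b (q ^ n) (ZG (suc n)) q (ZG (suc (suc n))) ⟩
      Y (suc n) + b * q ^ n * ZG (suc n)          ∎

    -- The first series left by the blue relation belongs to no state. `T-step` expands it, and the
    -- blue relation read backwards one size later collects the pieces into the `ZB (suc n)`
    -- contained in `X (suc n)`.
    ZB-step : ∀ n → ZB n ≈ X (suc n) + c * q ^ n * ZB (suc n)
    ZB-step n = begin
      ZB n                                        ≈⟨ T-contiguous₃ (1 ℕ.+ n) (1 ℕ.+ n) n ⟩
      T (1 ℕ.+ n) (1 ℕ.+ n) (2 ℕ.+ n) + c * q ^ n * (ZB (suc n) + q * t₃)
        ≈⟨ +-congʳ (T-step (1 ℕ.+ n) (1 ℕ.+ n) (2 ℕ.+ n)) ⟩
      t₁ + ((a * q ^ suc n + b * q ^ suc n) * t₂ + c * (q * (q * q ^ n)) * t₄)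
        + c * q ^ n * (ZB (suc n) + q * t₃)
        ≈⟨ solve 10 (λ a b c q Q t₁ t₂ t₃ t₄ z →
             t₁ :+ ((a :* (q :* Q) :+ b :* (q :* Q)) :* t₂ :+ c :* (q :* (q :* Q)) :* t₄)
               :+ c :* Q :* (z :+ q :* t₃) :=
             t₁ :+ c :* (q :* Q) :* (t₃ :+ q :* t₄) :+ b :* (q :* Q) :* t₂
               :+ a :* (q :* Q) :* t₂ :+ c :* Q :* z)
             refl a b c q (q ^ n) t₁ t₂ t₃ t₄ (ZB (suc n)) ⟩
      t₁ + c * q ^ suc n * (t₃ + q * t₄) + b * q ^ suc n * t₂ + a * q ^ suc n * t₂
        + c * q ^ n * ZB (suc n)
        ≈⟨ +-congʳ (+-congʳ (+-congʳ (T-contiguous₃ (2 ℕ.+ n) (2 ℕ.+ n) (1 ℕ.+ n)))) ⟨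
      X (suc n) + c * q ^ n * ZB (suc n)          ∎
      where
      t₁ t₂ t₃ t₄ : Carrier
      t₁ = T (2 ℕ.+ n) (2 ℕ.+ n) (3 ℕ.+ n)
      t₂ = ZG (suc (suc n))
      t₃ = T (3 ℕ.+ n) (3 ℕ.+ n) (2 ℕ.+ n)
      t₄ = T (4 ℕ.+ n) (4 ℕ.+ n) (3 ℕ.+ n)

    Y-step : ∀ n → Y n ≈ X (suc n) + b * q ^ n * ZG (suc n) + c * q ^ n * ZB (suc n)
    Y-step n = trans (+-congʳ (ZB-step n))
      (solve 3 (λ x z w → x :+ w :+ z := x :+ z :+ w) refl (X (suc n)) _ _)

    X-step : ∀ n → X n ≈ X (suc n) + a * q ^ n * ZG (suc n) + b * q ^ n * ZG (suc n)
                           + c * q ^ n * ZB (suc n)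
    X-step n = trans (+-congʳ (Y-step n))
      (solve 4 (λ x r g b → x :+ g :+ b :+ r := x :+ r :+ g :+ b) refl (X (suc n)) _ _ _)

    -- The red relation at (2,2,1) and the blue relation at (4,2,1) end in the same bracket `w`. For
    -- a = bc the red coefficient a q² is bq times the blue coefficient cq, so the terms regroup as
    -- bq times `T 4 2 1`.
    Y₁≈[1+bq]T : a ≈ b * c → Y 1 ≈ (1# + b * q) * T 4 2 1
    Y₁≈[1+bq]T a≈bc = begin
      T 2 2 1 + b * (q * 1#) * T 4 2 3
        ≈⟨ +-congʳ (T-contiguous₁ 2 2 1) ⟩
      T 4 2 1 + a * (q * (q * 1#)) * w + b * (q * 1#) * T 4 2 3
        ≈⟨ +-congʳ (+-congˡ (*-congʳ (*-congʳ a≈bc))) ⟩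
      T 4 2 1 + b * c * (q * (q * 1#)) * w + b * (q * 1#) * T 4 2 3
        ≈⟨ solve 6 (λ b c q w s t →
             s :+ b :* c :* (q :* (q :* con 1)) :* w :+ b :* (q :* con 1) :* t :=
             s :+ b :* q :* (t :+ c :* (q :* con 1) :* w)) refl b c q w (T 4 2 1) (T 4 2 3) ⟩
      T 4 2 1 + b * q * (T 4 2 3 + c * (q * 1#) * w)
        ≈⟨ +-congˡ (*-congˡ (T-contiguous₃ 4 2 1)) ⟨
      T 4 2 1 + b * q * T 4 2 1
        ≈⟨ solve 2 (λ u t → t :+ u :* t := (con 1 :+ u) :* t) refl (b * q) (T 4 2 1) ⟩
      (1# + b * q) * T 4 2 1 ∎
      where
      w : Carrier
      w = T 5 3 2 + q * T 6 4 3

-- The partitions as paths of an automaton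

open import Defs using
  ( Color; R; G; B; Part; size; color; _≟ᶜ_; _≽_
  ; Forbidden; R1R; R2R; R1B; G1R; G2R; G1B; B1R; B1G )

-- A state records which colors the part of the next size may have: afterRG and
-- afterB follow a part of the current size, noR follows a gap of exactly one
-- size above a red or green part, and free is the remaining case.  The empty
-- partition starts in noR, because 1_R is excluded.
data State : Set where
  free noR afterRG afterB : State

skipTo : State → State
skipTo free    = free
skipTo noR     = free
skipTo afterRG = noR
skipTo afterB  = free

after : Color → State
after R = afterRG
after G = afterRG
after B = afterB

data Allowed : State → Color → Set where
  free-any  : ∀ {c} → Allowed free c
  noR-G     : Allowed noR G
  noR-B     : Allowed noR B
  afterRG-G : Allowed afterRG G
  afterB-B  : Allowed afterB B

-- Every size from 1 to `k` costs one step, also when no part has it, so that the automaton sees the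
-- gaps.
data Chain : State → ℕ → List Part → Set where
  start : Chain noR 0 []
  skip  : ∀ {s k as} → Chain s k as → Chain (skipTo s) (suc k) as
  add   : ∀ {s k as c} → Allowed s c → Chain s k as → Chain (after c) (suc k) ((suc k , c) ∷ as)

sizes≤ : ∀ {s k as} → Chain s k as → All (λ a → size a ≤ k) as
sizes≤ start      = []
sizes≤ (skip ch)  = All.map ℕ.m≤n⇒m≤1+n (sizes≤ ch)
sizes≤ (add _ ch) = ℕ.≤-refl ∷ All.map ℕ.m≤n⇒m≤1+n (sizes≤ ch)

sizes≥1 : ∀ {s k as} → Chain s k as → All (λ a → 1 ≤ size a) as
sizes≥1 start      = []
sizes≥1 (skip ch)  = sizes≥1 ch
sizes≥1 (add _ ch) = s≤s z≤n ∷ sizes≥1 ch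

size≤ : ∀ {s k as a} → Chain s k as → a ∈ as → size a ≤ k
size≤ ch = All.lookup (sizes≤ ch)

linked : ∀ {s k as} → Chain s k as → Linked _≽_ as
linked start                 = []
linked (skip ch)             = linked ch
linked (add {as = []} _ _)     = [-]
linked (add {as = _ ∷ _} _ ch) = inj₁ (s≤s (size≤ ch (here ≡.refl))) ∷ linked ch

unique-sizes : ∀ {s k as} → Chain s k as → Unique (map size as)
unique-sizes start      = []
unique-sizes (skip ch)  = unique-sizes ch
unique-sizes (add _ ch) =
  All.map⁺ (All.map (λ b≤k sk≡b → ℕ.1+n≰n (ℕ.≤-trans (ℕ.≤-reflexive sk≡b) b≤k)) (sizes≤ ch))
  ∷ unique-sizes ch

-- A part of size `k` can only come from the last step, which fixes the state.
top-RG : ∀ {s k as} → Chain s k as → (k , R) ∈ as ⊎ (k , G) ∈ as → s ≡ afterRG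
top-RG (skip ch) (inj₁ m)               = contradiction (size≤ ch m) ℕ.1+n≰n
top-RG (skip ch) (inj₂ m)               = contradiction (size≤ ch m) ℕ.1+n≰n
top-RG (add _ ch) (inj₁ (here ≡.refl))  = ≡.refl
top-RG (add _ ch) (inj₁ (there m))      = contradiction (size≤ ch m) ℕ.1+n≰n
top-RG (add _ ch) (inj₂ (here ≡.refl))  = ≡.refl
top-RG (add _ ch) (inj₂ (there m))      = contradiction (size≤ ch m) ℕ.1+n≰n
top-RG start (inj₁ ())
top-RG start (inj₂ ())

top-B : ∀ {s k as} → Chain s k as → (k , B) ∈ as → s ≡ afterB
top-B (skip ch) m              = contradiction (size≤ ch m) ℕ.1+n≰n
top-B (add _ ch) (here ≡.refl) = ≡.refl
top-B (add _ ch) (there m)     = contradiction (size≤ ch m) ℕ.1+n≰n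

after≢free : ∀ c → after c ≢ free
after≢free R ()
after≢free G ()
after≢free B ()

-- One size above a red or green part, a skip leads to `noR` and an addition to a state after a
-- part; neither is `free`.
below-top : ∀ {s k as} → Chain s (suc k) as → (k , R) ∈ as ⊎ (k , G) ∈ as → s ≢ free
below-top (skip ch) m eq with top-RG ch m
below-top (skip ch) m () | ≡.refl
below-top (add {c = c} _ ch) m eq = after≢free c eq

forbidden-< : ∀ {a b} → Forbidden a b → size a < size b
forbidden-< (R1R _) = ℕ.≤-refl
forbidden-< (R2R _) = ℕ.m≤n⇒m≤1+n ℕ.≤-refl
forbidden-< (R1B _) = ℕ.≤-refl
forbidden-< (G1R _) = ℕ.≤-refl
forbidden-< (G2R _) = ℕ.m≤n⇒m≤1+n ℕ.≤-refl
forbidden-< (G1B _) = ℕ.≤-refl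
forbidden-< (B1R _) = ℕ.≤-refl
forbidden-< (B1G _) = ℕ.≤-refl

-- Conflicts at distance one contradict the state that the lower part forces. Conflicts at distance
-- two end in a red part, which only `free` admits.
allowed⇒¬forbidden : ∀ {s k as c a} → Chain s k as → Allowed s c → a ∈ as →
                     ¬ Forbidden a (suc k , c)
allowed⇒¬forbidden ch al m (R1R _) with top-RG ch (inj₁ m)
allowed⇒¬forbidden ch () m (R1R _) | ≡.refl
allowed⇒¬forbidden ch free-any m (R2R _) = below-top ch (inj₁ m) ≡.refl
allowed⇒¬forbidden ch al m (R1B _) with top-RG ch (inj₁ m)
allowed⇒¬forbidden ch () m (R1B _) | ≡.refl
allowed⇒¬forbidden ch al m (G1R _) with top-RG ch (inj₂ m)
allowed⇒¬forbidden ch () m (G1R _) | ≡.refl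
allowed⇒¬forbidden ch free-any m (G2R _) = below-top ch (inj₂ m) ≡.refl
allowed⇒¬forbidden ch al m (G1B _) with top-RG ch (inj₂ m)
allowed⇒¬forbidden ch () m (G1B _) | ≡.refl
allowed⇒¬forbidden ch al m (B1R _) with top-B ch m
allowed⇒¬forbidden ch () m (B1R _) | ≡.refl
allowed⇒¬forbidden ch al m (B1G _) with top-B ch m
allowed⇒¬forbidden ch () m (B1G _) | ≡.refl

NonForbidden : List Part → Set
NonForbidden as = ∀ {a b} → Forbidden a b → ¬ (a ∈ as × b ∈ as)

nonForbidden : ∀ {s k as} → Chain s k as → NonForbidden as
nonForbidden (skip ch)   f ms = nonForbidden ch f ms
nonForbidden (add al ch) f (here ≡.refl , here eq) =
  ℕ.<-irrefl (≡.cong size (≡.sym eq)) (forbidden-< f)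
nonForbidden (add al ch) f (here ≡.refl , there m) =
  ℕ.<⇒≱ (forbidden-< f) (ℕ.m≤n⇒m≤1+n (size≤ ch m))
nonForbidden (add al ch) f (there m , here ≡.refl) = allowed⇒¬forbidden ch al m f
nonForbidden (add al ch) f (there m , there m′)    = nonForbidden ch f (m , m′)

start-state : ∀ {s as} → Chain s 0 as → s ≡ noR
start-state start = ≡.refl

1R∉ : ∀ {s k as} → Chain s k as → (1 , R) ∉ as
1R∉ (skip ch) m = 1R∉ ch m
-- A part of size 1 is added directly to `start`, whose state `noR` refuses red.
1R∉ (add al ch) (here ≡.refl) with start-state ch
1R∉ (add () ch) (here ≡.refl) | ≡.refl
1R∉ (add al ch) (there m) = 1R∉ ch m

-- A certificate that the exclusions of a state are forced, either by a part that is present or, for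
-- `noR` at 0, by the ban on 1_R. The state `free` excludes nothing, and `k ≡ k` stands for truth.
Reason : State → ℕ → List Part → Set
Reason free    k as = k ≡ k
Reason noR     k as = k ≡ 0 ⊎ ∃[ j ] k ≡ suc j × ((j , R) ∈ as ⊎ (j , G) ∈ as)
Reason afterRG k as = (k , R) ∈ as ⊎ (k , G) ∈ as
Reason afterB  k as = (k , B) ∈ as

reason : ∀ {s k as} → Chain s k as → Reason s k as
reason start                   = inj₁ ≡.refl
reason (skip {free} ch)        = ≡.refl
reason (skip {noR} ch)         = ≡.refl
reason (skip {afterRG} ch)     = inj₂ (_ , ≡.refl , reason ch)
reason (skip {afterB} ch)      = ≡.refl
reason (add {c = R} _ ch)      = inj₁ (here ≡.refl)
reason (add {c = G} _ ch)      = inj₂ (here ≡.refl)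
reason (add {c = B} _ ch)      = here ≡.refl

nonForbidden⇒allowed : ∀ {s k c as} → All (λ a → 1 ≤ size a) as → Reason s k as →
  NonForbidden ((suc k , c) ∷ as) → (1 , R) ∉ (suc k , c) ∷ as → Allowed s c
nonForbidden⇒allowed {free} pos r nf 1R∉ = free-any
nonForbidden⇒allowed {noR} {c = G} pos r nf 1R∉ = noR-G
nonForbidden⇒allowed {noR} {c = B} pos r nf 1R∉ = noR-B
nonForbidden⇒allowed {noR} {c = R} pos (inj₁ ≡.refl) nf 1R∉ = contradiction (here ≡.refl) 1R∉
nonForbidden⇒allowed {noR} {c = R} pos (inj₂ (j , ≡.refl , inj₁ m)) nf 1R∉ =
  ⊥-elim (nf (R2R (All.lookup pos m)) (there m , here ≡.refl))
nonForbidden⇒allowed {noR} {c = R} pos (inj₂ (j , ≡.refl , inj₂ m)) nf 1R∉ =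
  ⊥-elim (nf (G2R (All.lookup pos m)) (there m , here ≡.refl))
nonForbidden⇒allowed {afterRG} {c = R} pos (inj₁ m) nf 1R∉ =
  ⊥-elim (nf (R1R (All.lookup pos m)) (there m , here ≡.refl))
nonForbidden⇒allowed {afterRG} {c = R} pos (inj₂ m) nf 1R∉ =
  ⊥-elim (nf (G1R (All.lookup pos m)) (there m , here ≡.refl))
nonForbidden⇒allowed {afterRG} {c = G} pos r nf 1R∉ = afterRG-G
nonForbidden⇒allowed {afterRG} {c = B} pos (inj₁ m) nf 1R∉ =
  ⊥-elim (nf (R1B (All.lookup pos m)) (there m , here ≡.refl))
nonForbidden⇒allowed {afterRG} {c = B} pos (inj₂ m) nf 1R∉ =
  ⊥-elim (nf (G1B (All.lookup pos m)) (there m , here ≡.refl))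
nonForbidden⇒allowed {afterB} {c = R} pos m nf 1R∉ =
  ⊥-elim (nf (B1R (All.lookup pos m)) (there m , here ≡.refl))
nonForbidden⇒allowed {afterB} {c = G} pos m nf 1R∉ =
  ⊥-elim (nf (B1G (All.lookup pos m)) (there m , here ≡.refl))
nonForbidden⇒allowed {afterB} {c = B} pos m nf 1R∉ = afterB-B

-- Recursion on `k`: the last step is `add` or `skip` according to whether the largest part has size
-- `k`. The state is recovered on the way.
chain : ∀ k {as} → All (λ a → 1 ≤ size a) as → AllPairs (λ a b → size a > size b) as →
        NonForbidden as → (1 , R) ∉ as → All (λ a → size a ≤ k) as → ∃[ s ] Chain s k as
chain zero    {[]}    _ _ _ _ _ = noR , start
chain zero    {a ∷ _} (1≤a ∷ _) _ _ _ (a≤0 ∷ _) = contradiction (ℕ.≤-trans 1≤a a≤0) λ ()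
chain (suc k) {[]}    pos ord nf 1R∉ _ with s , ch ← chain k {[]} [] [] nf 1R∉ [] =
  skipTo s , skip ch
chain (suc k) {(j , c) ∷ as} pos@(_ ∷ pos′) ord@(as<j ∷ ord′) nf 1R∉ (j≤1+k ∷ as≤) with j ℕ.≟ suc k
... | no j≢1+k
  with j≤k ← ℕ.s≤s⁻¹ (ℕ.≤∧≢⇒< j≤1+k j≢1+k)
  with s , ch ← chain k pos ord nf 1R∉
         (j≤k ∷ All.map (λ b<j → ℕ.≤-trans (ℕ.<⇒≤ b<j) j≤k) as<j) = skipTo s , skip ch
... | yes ≡.refl
  with s , ch ← chain k pos′ ord′ (λ f (m , m′) → nf f (there m , there m′)) (1R∉ ∘ there)
                  (All.map ℕ.s≤s⁻¹ as<j) =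
  after c , add (nonForbidden⇒allowed pos′ (reason ch) nf 1R∉) ch

-- Once sizes are distinct, the tie-break by color in `≽` never occurs.
descending : ∀ {as} → Linked _≽_ as → Unique (map size as) →
             AllPairs (λ a b → size a > size b) as
descending {as} l u = AllPairs.zipWith (λ (b≤a , a≢b) → ℕ.≤∧≢⇒< b≤a (a≢b ∘ ≡.sym))
  (Linked⇒AllPairs (λ b≤a c≤b → ℕ.≤-trans c≤b b≤a) (Linked.map ≽⇒≥ l) , AllPairs.map⁻ u)
  where
  ≽⇒≥ : ∀ {a b} → a ≽ b → size b ≤ size a
  ≽⇒≥ (inj₁ b<a)       = ℕ.<⇒≤ b<a
  ≽⇒≥ (inj₂ (a≡b , _)) = ℕ.≤-reflexive (≡.sym a≡b)

-- Enumeration of the paths of a given length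

record Configuration (k : ℕ) : Set where
  constructor configuration
  field
    {state}    : State
    {partList} : List Part
    isChain    : Chain state k partList
open Configuration public

additions extend : ∀ {k} → Configuration k → List (Configuration (suc k))
additions (configuration {free} ch)    =
  configuration (add {c = R} free-any ch) ∷ configuration (add {c = G} free-any ch) ∷
  configuration (add {c = B} free-any ch) ∷ []
additions (configuration {noR} ch)     =
  configuration (add noR-G ch) ∷ configuration (add noR-B ch) ∷ []
additions (configuration {afterRG} ch) = configuration (add afterRG-G ch) ∷ []
additions (configuration {afterB} ch)  = configuration (add afterB-B ch) ∷ []
extend x = configuration (skip (isChain x)) ∷ additions x

configurations : ∀ k → List (Configuration k)
configurations zero    = configuration start ∷ []
configurations (suc k) = concatMap extend (configurations k)

configuration-∈ : ∀ {s k as} (ch : Chain s k as) → configuration ch ∈ configurations k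
configuration-∈ start       = here ≡.refl
configuration-∈ (skip ch)   =
  ∈-concatMap⁺ extend (Any.map (λ { ≡.refl → here ≡.refl }) (configuration-∈ ch))
configuration-∈ (add al ch) =
  ∈-concatMap⁺ extend (Any.map (λ { ≡.refl → there (added al) }) (configuration-∈ ch))
  where
  added : ∀ {s c} (al : Allowed s c) {as} {ch : Chain s _ as} →
          configuration (add al ch) ∈ additions (configuration ch)
  added (free-any {R}) = here ≡.refl
  added (free-any {G}) = there (here ≡.refl)
  added (free-any {B}) = there (there (here ≡.refl))
  added noR-G          = here ≡.refl
  added noR-B          = there (here ≡.refl)
  added afterRG-G      = here ≡.refl
  added afterB-B       = here ≡.refl

-- Compared are the lists of parts rather than the paths, because the list is what determines a
-- partition.
Distinct : ∀ {k} → List (Configuration k) → Set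
Distinct = AllPairs λ x z → partList x ≢ partList z

-- A left inverse of extension: removing the newest size recovers the parent, so extensions of
-- different parents differ.
dropSize : ℕ → List Part → List Part
dropSize k []       = []
dropSize k (a ∷ as) with size a ℕ.≟ k
... | yes _ = as
... | no  _ = a ∷ as

dropSize-> : ∀ {k as} → All (λ a → size a ≤ k) as → dropSize (suc k) as ≡ as
dropSize-> []          = ≡.refl
dropSize-> {k} {a ∷ _} (a≤k ∷ _) with size a ℕ.≟ suc k
... | yes a≡1+k = contradiction (ℕ.≤-trans (ℕ.≤-reflexive (≡.sym a≡1+k)) a≤k) ℕ.1+n≰n
... | no  _     = ≡.refl

dropSize-≡ : ∀ k {c as} → dropSize k ((k , c) ∷ as) ≡ as
dropSize-≡ k with k ℕ.≟ k
... | yes _  = ≡.refl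
... | no k≢k = contradiction ≡.refl k≢k

extend-drop : ∀ {k} (x : Configuration k) →
              All (λ z → dropSize (suc k) (partList z) ≡ partList x) (extend x)
extend-drop {k} x@(configuration {s} ch) = dropSize-> (sizes≤ ch) ∷ added s ch
  where
  added : ∀ s {as} (ch : Chain s k as) →
          All (λ z → dropSize (suc k) (partList z) ≡ as) (additions (configuration ch))
  added free    ch = dropSize-≡ (suc k) ∷ dropSize-≡ (suc k) ∷ dropSize-≡ (suc k) ∷ []
  added noR     ch = dropSize-≡ (suc k) ∷ dropSize-≡ (suc k) ∷ []
  added afterRG ch = dropSize-≡ (suc k) ∷ []
  added afterB  ch = dropSize-≡ (suc k) ∷ []

extend-distinct : ∀ {k} (x : Configuration k) → Distinct (extend x)
extend-distinct {k} (configuration {s} ch) = distinct s ch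
  where
  ≢-add : ∀ {s c as} → Chain s k as → as ≢ (suc k , c) ∷ as
  ≢-add {c = c} ch eq = contradiction (size≤ ch (≡.subst ((suc k , c) ∈_) (≡.sym eq) (here ≡.refl))) ℕ.1+n≰n

  distinct : ∀ s {as} (ch : Chain s k as) → Distinct (extend (configuration ch))
  distinct free    ch = (≢-add ch ∷ ≢-add ch ∷ ≢-add ch ∷ []) ∷ ((λ ()) ∷ (λ ()) ∷ []) ∷
                        ((λ ()) ∷ []) ∷ [] ∷ []
  distinct noR     ch = (≢-add ch ∷ ≢-add ch ∷ []) ∷ ((λ ()) ∷ []) ∷ [] ∷ []
  distinct afterRG ch = (≢-add ch ∷ []) ∷ [] ∷ []
  distinct afterB  ch = (≢-add ch ∷ []) ∷ [] ∷ []

configurations-distinct : ∀ k → Distinct (configurations k)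
configurations-distinct zero    = [] ∷ []
configurations-distinct (suc k) = AllPairs.concat⁺
  (All.map⁺ (All.universal extend-distinct (configurations k)))
  (AllPairs.map⁺ (AllPairs.map separate (configurations-distinct k)))
  where
  separate : ∀ {x z : Configuration k} → partList x ≢ partList z →
             All (λ u → All (λ v → partList u ≢ partList v) (extend z)) (extend x)
  separate {x} {z} x≢z = All.map (λ ux → All.map (λ vz u≡v →
    x≢z (≡.trans (≡.sym ux) (≡.trans (≡.cong (dropSize (suc k)) u≡v) vz)))
    (extend-drop z)) (extend-drop x)

-- Weights of configurations and their conserved total

module Weights (A : CommutativeRing 0ℓ 0ℓ) (Σ : Summation A) (Φ : Factors A) where
  open CommutativeRing A
  open Summation Σ using (Order)
  open Factors Φ using (q)
  open Contiguity A Σ Φ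
  open import Algebra.Properties.CommutativeSemiring.Exp commutativeSemiring
  open import Algebra.Solver.Ring.NaturalCoefficients.Default commutativeSemiring
    using (solve; _:=_; _:+_; _:*_; con)
  open import Relation.Binary.Reasoning.Setoid setoid

  total : List Carrier → Carrier
  total = foldr _+_ 0#

  total-++ : ∀ xs ys → total (xs ++ ys) ≈ total xs + total ys
  total-++ []       ys = sym (+-identityˡ _)
  total-++ (x ∷ xs) ys = trans (+-congˡ (total-++ xs ys)) (sym (+-assoc _ _ _))

  total-concatMap : ∀ {I J : Set} (f : I → List J) (v : I → Carrier) (w : J → Carrier) →
    (∀ x → v x ≈ total (map w (f x))) → ∀ xs → total (map v xs) ≈ total (map w (concatMap f xs))
  total-concatMap f v w v≈ []       = refl
  total-concatMap f v w v≈ (x ∷ xs) = begin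
    v x + total (map v xs)
      ≈⟨ +-cong (v≈ x) (total-concatMap f v w v≈ xs) ⟩
    total (map w (f x)) + total (map w (concatMap f xs))
      ≈⟨ total-++ (map w (f x)) _ ⟨
    total (map w (f x) ++ map w (concatMap f xs))
      ≡⟨ ≡.cong total (map-++ w (f x) (concatMap f xs)) ⟨
    total (map w (f x ++ concatMap f xs)) ∎

  module _ {a b c : Carrier} (oa : Order 1 a) (ob : Order 1 b) (oc : Order 1 c) where

    colorWeight : Color → Carrier
    colorWeight R = a
    colorWeight G = b
    colorWeight B = c

    count : Color → List Part → ℕ
    count col as = length (filter (λ p → color p ≟ᶜ col) as)

    weight : List Part → Carrier
    weight as = a ^ count R as * b ^ count G as * c ^ count B as * q ^ sumℕ (map size as)

    weight-∷ : ∀ j col as → weight ((j , col) ∷ as) ≈ colorWeight col * q ^ j * weight as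
    weight-∷ j R as = trans (*-congˡ (^-homo-* q j (sumℕ (map size as))))
      (solve 6 (λ a A B C Q′ Q → a :* A :* B :* C :* (Q′ :* Q) := a :* Q′ :* (A :* B :* C :* Q))
        refl a _ _ _ _ _)
    weight-∷ j G as = trans (*-congˡ (^-homo-* q j (sumℕ (map size as))))
      (solve 6 (λ b A B C Q′ Q → A :* (b :* B) :* C :* (Q′ :* Q) := b :* Q′ :* (A :* B :* C :* Q))
        refl b _ _ _ _ _)
    weight-∷ j B as = trans (*-congˡ (^-homo-* q j (sumℕ (map size as))))
      (solve 6 (λ c A B C Q′ Q → A :* B :* (c :* C) :* (Q′ :* Q) := c :* Q′ :* (A :* B :* C :* Q))
        refl c _ _ _ _ _)

    -- stateSeries s n is the generating function of the parts of size ≥ n that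
    -- may be added in state s.
    stateSeries : State → ℕ → Carrier
    stateSeries free    = X oa ob oc
    stateSeries noR     = Y oa ob oc
    stateSeries afterRG = ZG oa ob oc
    stateSeries afterB  = ZB oa ob oc

    -- Deciding one more size merely redistributes this product among the extensions; that is the
    -- content of the transfer equation of the state.
    contribution : ∀ {k} → Configuration k → Carrier
    contribution {k} x = weight (partList x) * stateSeries (state x) (suc k)

    contribution-add : ∀ k col as s →
      weight as * (colorWeight col * q ^ suc k * s) ≈ weight ((suc k , col) ∷ as) * s
    contribution-add k col as s = trans
      (solve 3 (λ w u s → w :* (u :* s) := u :* w :* s) refl (weight as) (colorWeight col * q ^ suc k) s)
      (*-congʳ (sym (weight-∷ (suc k) col as)))

    distribute₁ : ∀ w x p {p′} → w * p ≈ p′ → w * (x + p) ≈ w * x + (p′ + 0#)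
    distribute₁ w x p p≈ = trans (distribˡ w x p) (+-congˡ (trans p≈ (sym (+-identityʳ _))))

    contribution-extend : ∀ {k} (x : Configuration k) →
                          contribution x ≈ total (map contribution (extend x))
    contribution-extend {k} (configuration {free} {as} ch) = begin
      w * X oa ob oc n
        ≈⟨ *-congˡ (X-step oa ob oc n) ⟩
      w * (X oa ob oc (suc n) + r + g + b′)
        ≈⟨ solve 5 (λ w x r g b → w :* (x :+ r :+ g :+ b) :=
             w :* x :+ (w :* r :+ (w :* g :+ (w :* b :+ con 0)))) refl w (X oa ob oc (suc n)) r g b′ ⟩
      w * X oa ob oc (suc n) + (w * r + (w * g + (w * b′ + 0#)))
        ≈⟨ +-congˡ (+-cong (contribution-add k R as _) (+-cong (contribution-add k G as _)
             (+-congʳ (contribution-add k B as _)))) ⟩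
      _ ∎
      where
      n = suc k
      w = weight as
      r = a * q ^ n * ZG oa ob oc (suc n)
      g = b * q ^ n * ZG oa ob oc (suc n)
      b′ = c * q ^ n * ZB oa ob oc (suc n)
    contribution-extend {k} (configuration {noR} {as} ch) = begin
      w * Y oa ob oc n
        ≈⟨ *-congˡ (Y-step oa ob oc n) ⟩
      w * (X oa ob oc (suc n) + g + b′)
        ≈⟨ solve 4 (λ w x g b → w :* (x :+ g :+ b) :=
             w :* x :+ (w :* g :+ (w :* b :+ con 0))) refl w (X oa ob oc (suc n)) g b′ ⟩
      w * X oa ob oc (suc n) + (w * g + (w * b′ + 0#))
        ≈⟨ +-congˡ (+-cong (contribution-add k G as _) (+-congʳ (contribution-add k B as _))) ⟩
      _ ∎
      where
      n = suc k
      w = weight as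
      g = b * q ^ n * ZG oa ob oc (suc n)
      b′ = c * q ^ n * ZB oa ob oc (suc n)
    contribution-extend {k} (configuration {afterRG} {as} ch) = trans
      (*-congˡ (ZG-step oa ob oc (suc k)))
      (distribute₁ (weight as) _ _ (contribution-add k G as _))
    contribution-extend {k} (configuration {afterB} {as} ch) = trans
      (*-congˡ (ZB-step oa ob oc (suc k)))
      (distribute₁ (weight as) _ _ (contribution-add k B as _))

    -- The total is an invariant of `k`. At `k` = 0 the only configuration is the empty one in state
    -- `noR`, facing size 1.
    configurations-total : ∀ k → total (map contribution (configurations k)) ≈ Y oa ob oc 1
    configurations-total zero    =
      solve 1 (λ y → con 1 :* con 1 :* con 1 :* con 1 :* y :+ con 0 := y) refl (Y oa ob oc 1)
    configurations-total (suc k) = trans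
      (sym (total-concatMap extend contribution contribution contribution-extend (configurations k)))
      (configurations-total k)

-- The ring of formal power series in y and q

open import Defs

module ℤ⟦q⟧ = PowerSeries ℤ.+-*-commutativeRing
module ℤ⟦y,q⟧ = PowerSeries ℤ⟦q⟧.commutativeRing
private module N = CommutativeRing ℤ⟦y,q⟧.commutativeRing

Σ-eval : ∀ (F : ℕ → ℕ → ℤ) k n →
         ℤ⟦y,q⟧.Σ[ F ] k n ≡ sumℤ (applyUpTo (λ i → F i n) k)
Σ-eval F zero    n = ≡.refl
Σ-eval F (suc k) n = ≡.cong (ℤ._+_ (F 0 n)) (Σ-eval (F ∘ suc) k n)

-- The double sum is a convolution in y of convolutions in q, once evaluation at `n` is moved inside
-- the outer sum.
*≈⊛ : ∀ f g → f * g ≈ f N.* g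
*≈⊛ f g m n = ≡.sym (Σ-eval (λ i → f i ℤ⟦q⟧.⊛ g (m ℕ.∸ i)) (suc m) n)

1≈1 : 1# ≈ N.1#
1≈1 zero    zero    = ≡.refl
1≈1 zero    (suc n) = ≡.refl
1≈1 (suc m) n       = ≡.refl

seriesRing : CommutativeRing 0ℓ 0ℓ
seriesRing = record
  { Carrier = Series
  ; _≈_     = _≈_
  ; _+_     = _+_
  ; _*_     = _*_
  ; -_      = -_
  ; 0#      = 0#
  ; 1#      = 1#
  ; isCommutativeRing = record
    { isRing = record
      { +-isAbelianGroup = N.+-isAbelianGroup
      ; *-cong     = *-cong′
      ; *-assoc    = λ f g h → begin
          (f * g) * h         ≈⟨ *≈⊛ (f * g) h ⟩
          (f * g) N.* h       ≈⟨ N.*-cong (*≈⊛ f g) (N.refl {h}) ⟩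
          (f N.* g) N.* h     ≈⟨ N.*-assoc f g h ⟩
          f N.* (g N.* h)     ≈⟨ N.*-cong (N.refl {f}) (*≈⊛ g h) ⟨
          f N.* (g * h)       ≈⟨ *≈⊛ f (g * h) ⟨
          f * (g * h)         ∎
      ; *-identity = identityˡ′ , λ f → N.trans (*-comm′ f 1#) (identityˡ′ f)
      ; distrib    = (λ h f g → begin
            h * (f + g)           ≈⟨ *-comm′ h (f + g) ⟩
            (f + g) * h           ≈⟨ distribʳ′ h f g ⟩
            f * h + g * h         ≈⟨ N.+-cong (*-comm′ f h) (*-comm′ g h) ⟩
            h * f + h * g         ∎)
          , distribʳ′
      }
    ; *-comm = *-comm′
    }
  }
  where
  open import Relation.Binary.Reasoning.Setoid N.setoid

  *-cong′ : ∀ {f f′ g g′} → f ≈ f′ → g ≈ g′ → f * g ≈ f′ * g′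
  *-cong′ {f} {f′} {g} {g′} p r = begin
    f * g        ≈⟨ *≈⊛ f g ⟩
    f N.* g      ≈⟨ N.*-cong p r ⟩
    f′ N.* g′    ≈⟨ *≈⊛ f′ g′ ⟨
    f′ * g′      ∎

  *-comm′ : ∀ f g → f * g ≈ g * f
  *-comm′ f g = begin
    f * g      ≈⟨ *≈⊛ f g ⟩
    f N.* g    ≈⟨ N.*-comm f g ⟩
    g N.* f    ≈⟨ *≈⊛ g f ⟨
    g * f      ∎

  identityˡ′ : ∀ f → 1# * f ≈ f
  identityˡ′ f = begin
    1# * f        ≈⟨ *≈⊛ 1# f ⟩
    1# N.* f      ≈⟨ N.*-cong 1≈1 (N.refl {f}) ⟩
    N.1# N.* f    ≈⟨ N.*-identityˡ f ⟩
    f             ∎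

  distribʳ′ : ∀ h f g → (f + g) * h ≈ f * h + g * h
  distribʳ′ h f g = begin
    (f + g) * h              ≈⟨ *≈⊛ (f + g) h ⟩
    (f + g) N.* h            ≈⟨ N.distribʳ h f g ⟩
    f N.* h + g N.* h        ≈⟨ N.+-cong (*≈⊛ f h) (*≈⊛ g h) ⟨
    f * h + g * h            ∎

private module S = CommutativeRing seriesRing
open RingLemmas seriesRing

-- Finite sums and degree filtrations

Σ : (ℕ → ℤ) → ℕ → ℤ
Σ f n = sumℤ (applyUpTo f n)

Σ-cong : ∀ {f g} n → (∀ i → i < n → f i ≡ g i) → Σ f n ≡ Σ g n
Σ-cong zero    eq = ≡.refl
Σ-cong (suc n) eq = ≡.cong₂ ℤ._+_ (eq 0 z<s) (Σ-cong n λ i i<n → eq (suc i) (s≤s i<n))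

Σ-zero : ∀ {f} n → (∀ i → i < n → f i ≡ 0ℤ) → Σ f n ≡ 0ℤ
Σ-zero zero    eq = ≡.refl
Σ-zero (suc n) eq = ≡.cong₂ ℤ._+_ (eq 0 z<s) (Σ-zero n λ i i<n → eq (suc i) (s≤s i<n))

Σ-extend : ∀ {f m n} → m ≤ n → (∀ i → m ≤ i → f i ≡ 0ℤ) → Σ f m ≡ Σ f n
Σ-extend {n = n} z≤n eq = ≡.sym (Σ-zero n λ i _ → eq i z≤n)
Σ-extend {f} (s≤s m≤n) eq =
  ≡.cong (ℤ._+_ (f 0)) (Σ-extend m≤n λ i m≤i → eq (suc i) (s≤s m≤i))

Σ-+ : ∀ f g n → Σ (λ i → f i ℤ.+ g i) n ≡ Σ f n ℤ.+ Σ g n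
Σ-+ f g zero    = ≡.refl
Σ-+ f g (suc n) = ≡.trans (≡.cong (ℤ._+_ (f 0 ℤ.+ g 0)) (Σ-+ (f ∘ suc) (g ∘ suc) n))
                          (interchange (f 0) (g 0) _ _)
  where open CommutativeSemigroupProperties ℤ.+-commutativeSemigroup using (interchange)

partialSum : (ℕ → Series) → ℕ → Series
partialSum f k m n = Σ (λ i → f i m n) k

*-partialSum : ∀ c f k → c * partialSum f k ≈ partialSum (λ i → c * f i) k
*-partialSum c f zero    = S.zeroʳ c
*-partialSum c f (suc k) = S.trans (S.distribˡ c (f 0) (partialSum (f ∘ suc) k))
                                   (S.+-congˡ {c * f 0} (*-partialSum c (f ∘ suc) k))

-- `w m n` is the degree assigned to y^m q^n. Additivity, expressed by `w-split`, makes agreement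
-- below degree `k` a congruence for products.
module Filtration (w : ℕ → ℕ → ℕ)
  (w-split : ∀ {i j m n} → i ≤ m → j ≤ n → w i j ℕ.+ w (m ℕ.∸ i) (n ℕ.∸ j) ≡ w m n)
  where

  infix 4 _≈[_]_
  _≈[_]_ : Series → ℕ → Series → Set
  f ≈[ k ] g = ∀ m n → w m n < k → f m n ≡ g m n

  ≈⇒≈[] : ∀ {k f g} → f ≈ g → f ≈[ k ] g
  ≈⇒≈[] eq m n _ = eq m n

  refl[] : ∀ {k} f → f ≈[ k ] f
  refl[] f m n _ = ≡.refl

  sym[] : ∀ {k f g} → f ≈[ k ] g → g ≈[ k ] f
  sym[] p m n lt = ≡.sym (p m n lt)

  trans[] : ∀ {k f g h} → f ≈[ k ] g → g ≈[ k ] h → f ≈[ k ] h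
  trans[] p r m n lt = ≡.trans (p m n lt) (r m n lt)

  weaken[] : ∀ {j k f g} → j ≤ k → f ≈[ k ] g → f ≈[ j ] g
  weaken[] j≤k p m n lt = p m n (ℕ.<-≤-trans lt j≤k)

  +-cong[] : ∀ {k f f′ g g′} → f ≈[ k ] f′ → g ≈[ k ] g′ → f + g ≈[ k ] f′ + g′
  +-cong[] p r m n lt = ≡.cong₂ ℤ._+_ (p m n lt) (r m n lt)

  -‿cong[] : ∀ {k f f′} → f ≈[ k ] f′ → - f ≈[ k ] - f′
  -‿cong[] p m n lt = ≡.cong ℤ.-_ (p m n lt)

  *-cong[] : ∀ {k f f′ g g′} → f ≈[ k ] f′ → g ≈[ k ] g′ → f * g ≈[ k ] f′ * g′
  *-cong[] p r m n lt = Σ-cong (suc m) λ i i≤m → Σ-cong (suc n) λ j j≤n →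
    let split = w-split (ℕ.s≤s⁻¹ i≤m) (ℕ.s≤s⁻¹ j≤n) in
    ≡.cong₂ ℤ._*_
      (p i j (ℕ.≤-<-trans (≡.subst (w i j ≤_) split (ℕ.m≤m+n _ _)) lt))
      (r (m ℕ.∸ i) (n ℕ.∸ j) (ℕ.≤-<-trans (≡.subst (w (m ℕ.∸ i) (n ℕ.∸ j) ≤_) split (ℕ.m≤n+m _ (w i j))) lt))

  Vanishes : ℕ → Series → Set
  Vanishes k f = f ≈[ k ] 0#

  -- In a product term of degree below j + k, one of the two factors lies below its own bound.
  Vanishes-* : ∀ {j k f g} → Vanishes j f → Vanishes k g → Vanishes (j ℕ.+ k) (f * g)
  Vanishes-* {j} {k} {f} {g} vf vg m n lt = Σ-zero (suc m) λ a a≤m → Σ-zero (suc n) λ b b≤n →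
    factor a b (w-split (ℕ.s≤s⁻¹ a≤m) (ℕ.s≤s⁻¹ b≤n))
    where
    factor : ∀ a b → w a b ℕ.+ w (m ℕ.∸ a) (n ℕ.∸ b) ≡ w m n →
             f a b ℤ.* g (m ℕ.∸ a) (n ℕ.∸ b) ≡ 0ℤ
    factor a b split with w a b ℕ.<? j
    ... | yes lt₁ = ≡.cong (ℤ._* g (m ℕ.∸ a) (n ℕ.∸ b)) (vf a b lt₁)
    ... | no ≮₁ with w (m ℕ.∸ a) (n ℕ.∸ b) ℕ.<? k
    ...   | yes lt₂ = ≡.trans (≡.cong (f a b ℤ.*_) (vg _ _ lt₂)) (ℤ.*-zeroʳ (f a b))
    ...   | no ≮₂ = contradiction (≡.subst (_< j ℕ.+ k) (≡.sym split) lt)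
                      (ℕ.≤⇒≯ (ℕ.+-mono-≤ (ℕ.≮⇒≥ ≮₁) (ℕ.≮⇒≥ ≮₂)))

  Vanishes-*ˡ : ∀ {k g} f → Vanishes k g → Vanishes k (f * g)
  Vanishes-*ˡ f = Vanishes-* {0} {f = f} λ m n ()

  Vanishes-*ʳ : ∀ {k f} g → Vanishes k f → Vanishes k (f * g)
  Vanishes-*ʳ {k} {f} g vf = trans[] (≈⇒≈[] (S.*-comm f g)) (Vanishes-*ˡ g vf)

  Vanishes-^ : ∀ {f} → Vanishes 1 f → ∀ k → Vanishes k (f ^ k)
  Vanishes-^ vf zero    m n ()
  Vanishes-^ vf (suc k) = Vanishes-* vf (Vanishes-^ vf k)

private
  +-split : ∀ {i j m n} → i ≤ m → j ≤ n →
            (i ℕ.+ j) ℕ.+ ((m ℕ.∸ i) ℕ.+ (n ℕ.∸ j)) ≡ m ℕ.+ n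
  +-split {i} {j} {m} {n} i≤m j≤n = ≡.trans (interchange i j (m ℕ.∸ i) (n ℕ.∸ j))
    (≡.cong₂ ℕ._+_ (ℕ.m+[n∸m]≡n i≤m) (ℕ.m+[n∸m]≡n j≤n))
    where open CommutativeSemigroupProperties ℕ.+-commutativeSemigroup using (interchange)

module ByDegree  = Filtration ℕ._+_ +-split
module ByyDegree = Filtration (λ m _ → m) (λ i≤m _ → ℕ.m+[n∸m]≡n i≤m)
module ByqDegree = Filtration (λ _ n → n) (λ _ j≤n → ℕ.m+[n∸m]≡n j≤n)

-- Reciprocals, and sums of families of growing y-degree

module _ where
  open ByDegree

  reciprocal : Series → Series
  reciprocal g m n = Σ (λ k → ((1# - g) ^ k) m n) (suc (m ℕ.+ n))

  geometric : ∀ g k → g * partialSum ((1# - g) ^_) k + (1# - g) ^ k ≈ 1#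
  geometric g zero    =
    S.trans (S.+-congʳ {1#} {g * partialSum ((1# - g) ^_) 0} {0#} (S.zeroʳ g)) (S.+-identityˡ 1#)
  geometric g (suc k) = begin
    g * (1# + partialSum (λ i → h * h ^ i) k) + h * h ^ k
      ≈⟨ S.+-congʳ {h * h ^ k} (S.*-congˡ {g} (S.+-congˡ {1#} (*-partialSum h (h ^_) k))) ⟨
    g * (1# + h * partialSum (h ^_) k) + h * h ^ k
      ≈⟨ geometric-step {g} {h} {partialSum (h ^_) k} {h ^ k} (x+[1-x]≈1 g) (geometric g k) ⟩
    1# ∎
    where
    open import Relation.Binary.Reasoning.Setoid S.setoid
    h = 1# - g

  -- A coefficient of degree d < k uses the powers up to d of 1 - g; the powers from d + 1 on vanish
  -- at degree d, so the sum may be lengthened to a common cut `k`.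
  reciprocal≈partialSum : ∀ {g} → g ≈[ 1 ] 1# → ∀ k →
                          reciprocal g ≈[ k ] partialSum ((1# - g) ^_) k
  reciprocal≈partialSum {g} g≈1 k m n lt = Σ-extend lt λ i lt′ →
    Vanishes-^ {1# - g} 1-g≈0 i m n lt′
    where
    1-g≈0 : Vanishes 1 (1# - g)
    1-g≈0 = trans[] (+-cong[] (refl[] 1#) (-‿cong[] g≈1)) (≈⇒≈[] (S.-‿inverseʳ 1#))

  *-reciprocal : ∀ g → g ≈[ 1 ] 1# → g * reciprocal g ≈ 1#
  *-reciprocal g g≈1 m n = begin
    (g * reciprocal g) m n
      ≡⟨ *-cong[] (refl[] g) (reciprocal≈partialSum g≈1 k) m n ℕ.≤-refl ⟩
    (g * partialSum (h ^_) k) m n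
      ≡⟨ ℤ.+-identityʳ _ ⟨
    (g * partialSum (h ^_) k) m n ℤ.+ 0ℤ
      ≡⟨ ≡.cong (ℤ._+_ ((g * partialSum (h ^_) k) m n)) (Vanishes-^ {h} 1-g≈0 k m n ℕ.≤-refl) ⟨
    (g * partialSum (h ^_) k + h ^ k) m n
      ≡⟨ geometric g k m n ⟩
    1# m n ∎
    where
    open ≡.≡-Reasoning
    -- One more than the degree of the coefficient, so that the remainder h^k vanishes at it.
    k = suc (m ℕ.+ n)
    h = 1# - g
    1-g≈0 : Vanishes 1 h
    1-g≈0 = trans[] (+-cong[] (refl[] 1#) (-‿cong[] g≈1)) (≈⇒≈[] (S.-‿inverseʳ 1#))

  q≈[1]0 : Vanishes 1 q
  q≈[1]0 zero    zero    lt = ≡.refl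
  q≈[1]0 zero    (suc n) (s≤s ())
  q≈[1]0 (suc m) n       (s≤s ())

  den : ℕ → Series
  den = pochhammer (q ^ 2) (q ^ 2)

  den≈[1]1 : ∀ n → den n ≈[ 1 ] 1#
  den≈[1]1 zero    = refl[] 1#
  den≈[1]1 (suc n) = trans[]
    (*-cong[] (den≈[1]1 n) (+-cong[] (refl[] 1#) (-‿cong[]
      (Vanishes-*ʳ ((q ^ 2) ^ n) (Vanishes-*ʳ (q ^ 1) q≈[1]0)))))
    (≈⇒≈[] (S.trans (S.*-identityˡ (1# - 0#)) (S.+-identityʳ 1#)))

  denominator : ℕ → ℕ → ℕ → Series
  denominator i j k = den i * den j * den k

  denominator≈[1]1 : ∀ i j k → denominator i j k ≈[ 1 ] 1#
  denominator≈[1]1 i j k = trans[]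
    (*-cong[] (*-cong[] (den≈[1]1 i) (den≈[1]1 j)) (den≈[1]1 k))
    (≈⇒≈[] (S.trans (S.*-identityʳ (1# * 1#)) (S.*-identityʳ 1#)))

module _ where
  open ByyDegree

  -- For a family whose member `i` has y-degree at least `i`, the coefficient of y^m sees only the
  -- indices up to `m`.
  Σ∞ : (ℕ → Series) → Series
  Σ∞ f m n = Σ (λ i → f i m n) (suc m)

  Σ∞≈partialSum : ∀ {f} → (∀ i → Vanishes i (f i)) → ∀ k → Σ∞ f ≈[ k ] partialSum f k
  Σ∞≈partialSum vf k m n lt = Σ-extend lt λ i lt′ → vf i m n lt′

-- An opaque copy of the multiplication: comparing nested products otherwise unfolds
-- every convolution.
opaque
  infixl 7 _⊗_
  _⊗_ : Series → Series → Series
  _⊗_ = _*_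

  ⊗≡* : ∀ f g → f ⊗ g ≡ f * g
  ⊗≡* f g = ≡.refl

  ⊗-isCommutativeRing : IsCommutativeRing _≈_ _+_ _⊗_ -_ 0# 1#
  ⊗-isCommutativeRing = S.isCommutativeRing

⊗≡ : ∀ {f g} f′ g′ → f ≡ f′ → g ≡ g′ → f ⊗ g ≡ f′ * g′
⊗≡ f g ≡.refl ≡.refl = ⊗≡* f g

⊗≡/ : ∀ {f} f′ g → f ≡ f′ → f ⊗ reciprocal g ≡ f′ / g
⊗≡/ f g ≡.refl = ⊗≡* f (reciprocal g)

⊗-ring : CommutativeRing 0ℓ 0ℓ
⊗-ring = record { isCommutativeRing = ⊗-isCommutativeRing }

open Exp (CommutativeRing.semiring ⊗-ring) using () renaming (_^_ to _^⊗_)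

^⊗≡^ : ∀ f n → f ^⊗ n ≡ f ^ n
^⊗≡^ f zero    = ≡.refl
^⊗≡^ f (suc n) = ≡.trans (≡.cong (f ⊗_) (^⊗≡^ f n)) (⊗≡* f (f ^ n))

opaque
  unfolding _⊗_

  ⊗-num-suc : ∀ n → pochhammer (- q) q (suc n) ≈ pochhammer (- q) q n ⊗ (1# + q ⊗ q ^ n)
  ⊗-num-suc n = S.*-congˡ {pochhammer (- q) q n} (1--xy q (q ^ n))

  ⊗-den-suc : ∀ n → den (suc n) + den n ⊗ (q ⊗ q ^ n ⊗ (q ⊗ q ^ n)) ≈ den n
  ⊗-den-suc n = den-step (den n) (square-^ q n)

  ⊗-den⁻¹-inverse : ∀ i j k → reciprocal (den i * den j * den k) ⊗ (den i ⊗ den j ⊗ den k) ≈ 1#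
  ⊗-den⁻¹-inverse i j k =
    S.trans (S.*-comm (reciprocal (denominator i j k)) (denominator i j k))
            (*-reciprocal (den i * den j * den k) (denominator≈[1]1 i j k))

⊗-factors : Factors ⊗-ring
⊗-factors = record
  { q       = q
  ; num     = pochhammer (- q) q
  ; den     = pochhammer (q ^ 2) (q ^ 2)
  ; den⁻¹   = λ i j k → reciprocal (pochhammer (q ^ 2) (q ^ 2) i *
      pochhammer (q ^ 2) (q ^ 2) j * pochhammer (q ^ 2) (q ^ 2) k)
  ; num-suc = λ n → ≡.subst (λ p → pochhammer (- q) q (suc n) ≈ pochhammer (- q) q n ⊗ (1# + q ⊗ p))
                            (≡.sym (^⊗≡^ q n)) (⊗-num-suc n)
  ; den-suc = λ n → ≡.subst (λ p → den (suc n) + den n ⊗ (q ⊗ p ⊗ (q ⊗ p)) ≈ den n)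
                            (≡.sym (^⊗≡^ q n)) (⊗-den-suc n)
  ; den⁻¹-inverse = ⊗-den⁻¹-inverse
  }

module _ where
  open ByyDegree

  opaque
    unfolding _⊗_

    Vanishes-⊗ : ∀ {j k f g} → Vanishes j f → Vanishes k g → Vanishes (j ℕ.+ k) (f ⊗ g)
    Vanishes-⊗ = Vanishes-*

    -- Multiplication by `c` combines coefficients with different cuts; below y-degree m + 1 all of
    -- them may be replaced by one partial sum.
    Σ∞-⊗ : ∀ c f → (∀ i → Vanishes i (f i)) → Σ∞ (λ i → c ⊗ f i) ≈ c ⊗ Σ∞ f
    Σ∞-⊗ c f vf m n = ≡.trans (≡.sym (*-partialSum c f (suc m) m n))
      (*-cong[] (refl[] c) (sym[] (Σ∞≈partialSum vf (suc m))) m n ℕ.≤-refl)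

  ⊗-summation : Summation ⊗-ring
  ⊗-summation = record
    { Order        = Vanishes
    ; Order-zero   = λ f m n ()
    ; Order-weaken = weaken[]
    ; Order-*      = Vanishes-⊗
    ; Σ∞           = Σ∞
    ; Order-Σ∞     = λ vf m n lt → Σ-zero (suc m) λ i _ → vf i m n lt
    ; Σ∞-cong      = λ eq m n → Σ-cong (suc m) λ i _ → eq i m n
    ; Σ∞-+         = λ f g m n → Σ-+ (λ i → f i m n) (λ i → g i m n) (suc m)
    ; Σ∞-*         = Σ∞-⊗
    ; Σ∞-suc       = λ f vf m n → ≡.cong (ℤ._+_ (f 0 m n))
        (Σ-extend (ℕ.n≤1+n m) λ i m≤i → vf (suc i) m n (s≤s m≤i))
    }

private module P = CommutativeRing ⊗-ring
open TripleSums ⊗-ring ⊗-summation using (Σ²; Σ³)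
open Contiguity ⊗-ring ⊗-summation ⊗-factors
open Coefficients ⊗-ring ⊗-factors using (E; q[_])
open Weights ⊗-ring ⊗-summation ⊗-factors

-- The two sums

sumℤ-++ : ∀ xs ys → sumℤ (xs ++ ys) ≡ sumℤ xs ℤ.+ sumℤ ys
sumℤ-++ []       ys = ≡.sym (ℤ.+-identityˡ (sumℤ ys))
sumℤ-++ (x ∷ xs) ys = ≡.trans (≡.cong (ℤ._+_ x) (sumℤ-++ xs ys)) (≡.sym (ℤ.+-assoc x _ _))

sumℤ-cartesianProduct : ∀ {A B : Set} (f : A × B → ℤ) xs ys →
  sumℤ (map f (cartesianProduct xs ys)) ≡ sumℤ (map (λ x → sumℤ (map (λ z → f (x , z)) ys)) xs)
sumℤ-cartesianProduct f []       ys = ≡.refl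
sumℤ-cartesianProduct f (x ∷ xs) ys = begin
  sumℤ (map f (map (x ,_) ys ++ cartesianProduct xs ys))
    ≡⟨ ≡.cong sumℤ (map-++ f (map (x ,_) ys) (cartesianProduct xs ys)) ⟩
  sumℤ (map f (map (x ,_) ys) ++ map f (cartesianProduct xs ys))
    ≡⟨ sumℤ-++ (map f (map (x ,_) ys)) _ ⟩
  sumℤ (map f (map (x ,_) ys)) ℤ.+ sumℤ (map f (cartesianProduct xs ys))
    ≡⟨ ≡.cong₂ ℤ._+_ (≡.cong sumℤ (≡.sym (map-∘ ys))) (sumℤ-cartesianProduct f xs ys) ⟩
  sumℤ (map (λ z → f (x , z)) ys) ℤ.+ sumℤ (map (λ x → sumℤ (map (λ z → f (x , z)) ys)) xs) ∎
  where open ≡.≡-Reasoning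

sumℤ-upTo : ∀ f n → sumℤ (map f (upTo n)) ≡ Σ f n
sumℤ-upTo f n = ≡.cong sumℤ (map-upTo f n)

sumℤ-upTo-× : ∀ {B : Set} (f : ℕ × B → ℤ) n zs →
  sumℤ (map f (cartesianProduct (upTo n) zs)) ≡ Σ (λ i → sumℤ (map (λ z → f (i , z)) zs)) n
sumℤ-upTo-× f n zs = ≡.trans (sumℤ-cartesianProduct f (upTo n) zs)
                             (sumℤ-upTo (λ i → sumℤ (map (λ z → f (i , z)) zs)) n)

-- At y-degree `m` the cube of indices up to `m` suffices: a triple outside it has an index above
-- `m`, hence a summand of order above `m`.
HasSum-cube : (f : ℕ × ℕ × ℕ → Series) →
  (∀ i j k → ByyDegree.Vanishes (i ℕ.+ j ℕ.+ k) (f (i , j , k))) →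
  HasSum f (Σ³ λ i j k → f (i , j , k))
HasSum-cube f vf m n = cube , unique , outside , sum≡
  where
  range : List ℕ
  range = upTo (suc m)

  cube : List (ℕ × ℕ × ℕ)
  cube = cartesianProduct range (cartesianProduct range range)

  unique = cartesianProduct⁺ (upTo⁺ (suc m)) (cartesianProduct⁺ (upTo⁺ (suc m)) (upTo⁺ (suc m)))

  outside : ∀ x → x ∉ cube → f x m n ≡ 0ℤ
  outside (i , j , k) x∉ with i ℕ.<? suc m | j ℕ.<? suc m | k ℕ.<? suc m
  ... | yes i< | yes j< | yes k< =
    contradiction (∈-cartesianProduct⁺ (∈-upTo⁺ i<) (∈-cartesianProduct⁺ (∈-upTo⁺ j<) (∈-upTo⁺ k<))) x∉
  ... | no i≮ | _ | _ = vf i j k m n (ℕ.<-≤-trans (ℕ.≮⇒≥ i≮)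
    (ℕ.≤-trans (ℕ.m≤m+n i j) (ℕ.m≤m+n (i ℕ.+ j) k)))
  ... | yes _ | no j≮ | _ = vf i j k m n (ℕ.<-≤-trans (ℕ.≮⇒≥ j≮)
    (ℕ.≤-trans (ℕ.m≤n+m j i) (ℕ.m≤m+n (i ℕ.+ j) k)))
  ... | yes _ | yes _ | no k≮ = vf i j k m n (ℕ.<-≤-trans (ℕ.≮⇒≥ k≮) (ℕ.m≤n+m k (i ℕ.+ j)))

  sum≡ : sumℤ (map (λ x → f x m n) cube) ≡ Σ³ (λ i j k → f (i , j , k)) m n
  sum≡ = ≡.trans (sumℤ-upTo-× (λ x → f x m n) (suc m) (cartesianProduct range range))
    (Σ-cong (suc m) λ i _ → ≡.trans (sumℤ-upTo-× (λ jk → f (i , jk) m n) (suc m) range)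
      (Σ-cong (suc m) λ j _ → sumℤ-upTo (λ k → f (i , j , k) m n) (suc m)))

HasSum-cong : ∀ {I : Set} {f g : I → Series} {S} → (∀ x → g x ≈ f x) → HasSum f S → HasSum g S
HasSum-cong g≈f sums m n with is , unique , outside , sum≡ ← sums m n = is , unique ,
  (λ x x∉ → ≡.trans (g≈f x m n) (outside x x∉)) ,
  ≡.trans (≡.cong sumℤ (map-cong (λ x → g≈f x m n) is)) sum≡

-- Stated for variables so that T-summand≡ matches the convolutions syntactically.
⊗≡summand : ∀ {p p′ a a′ b b′ c c′} n d → p ≡ p′ → a ≡ a′ → b ≡ b′ → c ≡ c′ →
            p ⊗ (a ⊗ b ⊗ c ⊗ n ⊗ reciprocal d) ≡ p′ * ((a′ * b′ * c′ * n) / d)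
⊗≡summand {p} {_} {a} {_} {b} {_} {c} n d ≡.refl ≡.refl ≡.refl ≡.refl =
  ⊗≡ p (a * b * c * n / d) ≡.refl
    (⊗≡/ (a * b * c * n) d (⊗≡ (a * b * c) n (⊗≡ (a * b) c (⊗≡* a b) ≡.refl) ≡.refl))

module _ (y₁ y₂ y₃ : Series) where

  T-summand T-summand⊗ : ℕ × ℕ × ℕ → Series
  T-summand (n₁ , n₂ , n₃) =
    q ^ (3 ℕ.* (n₁ C 2) ℕ.+ (n₂ C 2) ℕ.+ (n₃ C 2)
           ℕ.+ n₁ ℕ.* n₂ ℕ.+ n₂ ℕ.* n₃ ℕ.+ n₃ ℕ.* n₁) *
    ((y₁ ^ n₁ * y₂ ^ n₂ * y₃ ^ n₃ * pochhammer (- q) q (n₁ ℕ.+ n₂ ℕ.+ n₃)) /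
     (pochhammer (q ^ 2) (q ^ 2) n₁ * pochhammer (q ^ 2) (q ^ 2) n₂
        * pochhammer (q ^ 2) (q ^ 2) n₃))
  T-summand⊗ (i , j , k) = q ^⊗ quadraticForm i j k ⊗
    (y₁ ^⊗ i ⊗ y₂ ^⊗ j ⊗ y₃ ^⊗ k ⊗ pochhammer (- q) q (i ℕ.+ j ℕ.+ k) ⊗
     reciprocal (pochhammer (q ^ 2) (q ^ 2) i * pochhammer (q ^ 2) (q ^ 2) j
        * pochhammer (q ^ 2) (q ^ 2) k))

  T-summand≡ : ∀ n₁ n₂ n₃ → T-summand⊗ (n₁ , n₂ , n₃) ≡ T-summand (n₁ , n₂ , n₃)
  T-summand≡ n₁ n₂ n₃ = ⊗≡summand
    {q ^⊗ quadraticForm n₁ n₂ n₃} {q ^ (3 ℕ.* (n₁ C 2) ℕ.+ (n₂ C 2) ℕ.+ (n₃ C 2)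
       ℕ.+ n₁ ℕ.* n₂ ℕ.+ n₂ ℕ.* n₃ ℕ.+ n₃ ℕ.* n₁)}
    {y₁ ^⊗ n₁} {y₁ ^ n₁} {y₂ ^⊗ n₂} {y₂ ^ n₂} {y₃ ^⊗ n₃} {y₃ ^ n₃}
    (pochhammer (- q) q (n₁ ℕ.+ n₂ ℕ.+ n₃))
    (pochhammer (q ^ 2) (q ^ 2) n₁ * pochhammer (q ^ 2) (q ^ 2) n₂ * pochhammer (q ^ 2) (q ^ 2) n₃)
    (^⊗≡^ q (quadraticForm n₁ n₂ n₃)) (^⊗≡^ y₁ n₁) (^⊗≡^ y₂ n₂) (^⊗≡^ y₃ n₃)

module _ where
  open ByyDegree using (Vanishes)

  IsT-sum : ∀ {y₁ y₂ y₃ a b c} → Vanishes 1 y₁ → Vanishes 1 y₂ → Vanishes 1 y₃ →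
            ∀ α β γ → a ≈ y₁ ⊗ q ^⊗ α → b ≈ y₂ ⊗ q ^⊗ β → c ≈ y₃ ⊗ q ^⊗ γ →
            IsT a b c (sum E α β γ y₁ y₂ y₃)
  IsT-sum {y₁} {y₂} {y₃} {a} {b} {c} o₁ o₂ o₃ α β γ a≈ b≈ c≈ = HasSum-cong {g = T-summand a b c} summand≈
    (HasSum-cube summand (term-summable o₁ o₂ o₃ E α β γ))
    where
    summand : ℕ × ℕ × ℕ → Series
    summand (i , j , k) = term E α β γ y₁ y₂ y₃ i j k

    summand≈ : ∀ x → T-summand a b c x ≈ summand x
    summand≈ (i , j , k) m n =
      ≡.trans (≡.cong (λ s → s m n) (≡.sym (T-summand≡ a b c i j k)))
              (term-literal α β γ a≈ b≈ c≈ i j k m n)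

-- The q-adic limit of the triple sum

module _ where
  open ByqDegree

  q≈[1]0′ : Vanishes 1 q
  q≈[1]0′ zero    zero    lt = ≡.refl
  q≈[1]0′ (suc m) zero    lt = ≡.refl
  q≈[1]0′ m       (suc n) (s≤s ())

  Vanishes-⊗ˡ : ∀ {k g} f → Vanishes k g → Vanishes k (f ⊗ g)
  Vanishes-⊗ˡ {k} {g} f o = ≡.subst (Vanishes k) (≡.sym (⊗≡* f g)) (Vanishes-*ˡ f o)

  Vanishes-⊗ʳ : ∀ {k f} g → Vanishes k f → Vanishes k (f ⊗ g)
  Vanishes-⊗ʳ {k} {f} g o = ≡.subst (Vanishes k) (≡.sym (⊗≡* f g)) (Vanishes-*ʳ g o)

  Vanishes-q[suc]^ : ∀ {k} i {α} → k ≤ α → Vanishes k (q[ suc i ] ^⊗ α)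
  Vanishes-q[suc]^ {k} i {α} k≤α = weaken[] k≤α (≡.subst (Vanishes α) (≡.sym (^⊗≡^ (q[ suc i ]) α))
    (Vanishes-^ (Vanishes-⊗ʳ (q[ i ]) q≈[1]0′) α))

  Σ∞-head : ∀ {k} f → (∀ i → Vanishes k (f (suc i))) → Σ∞ f ≈[ k ] f 0
  Σ∞-head f vf m n lt =
    ≡.trans (≡.cong (ℤ._+_ (f 0 m n)) (Σ-zero m λ i _ → vf i m n lt)) (ℤ.+-identityʳ _)

  Vanishes-Σ∞ : ∀ {k} f → (∀ i → Vanishes k (f i)) → Vanishes k (Σ∞ f)
  Vanishes-Σ∞ f vf m n lt = Σ-zero (suc m) λ i _ → vf i m n lt

  -- A positive index brings in a factor q^α, q^β or q^γ, so modulo q^k only the summand at (0,0,0)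
  -- survives, and it equals 1.
  sum≈[]1 : ∀ {k} y₁ y₂ y₃ α β γ → k ≤ α → k ≤ β → k ≤ γ → sum E α β γ y₁ y₂ y₃ ≈[ k ] 1#
  sum≈[]1 {k} y₁ y₂ y₃ α β γ k≤α k≤β k≤γ =
    trans[] (Σ∞-head (λ i → Σ² (t i)) λ i →
      Vanishes-Σ∞ (λ j → Σ∞ (t (suc i) j)) λ j → Vanishes-Σ∞ (t (suc i) j) (first i j))
    (trans[] (Σ∞-head (λ j → Σ∞ (t 0 j)) λ j → Vanishes-Σ∞ (t 0 (suc j)) (second j))
    (trans[] (Σ∞-head (t 0 0) third)
      (≈⇒≈[] (P.trans {t 0 0 0} (term-000 (P.refl {1#}) y₁ y₂ y₃ α β γ) den⁻¹-000))))
    where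
    den⁻¹-000 : reciprocal (denominator 0 0 0) ≈ 1#
    den⁻¹-000 = P.trans
      (P.sym (P.trans
        (P.*-congˡ (P.trans (P.*-congʳ (P.*-identityˡ 1#)) (P.*-identityˡ 1#)))
        (P.*-identityʳ (reciprocal (denominator 0 0 0)))))
      (Factors.den⁻¹-inverse ⊗-factors 0 0 0)

    t : ℕ → ℕ → ℕ → Series
    t = term E α β γ y₁ y₂ y₃

    by-powers : ∀ i j l → Vanishes k (powers α β γ i j l) → Vanishes k (t i j l)
    by-powers i j l o = Vanishes-⊗ʳ (monomial y₁ y₂ y₃ i j l) (Vanishes-⊗ˡ (E i j l) o)

    first : ∀ i j l → Vanishes k (t (suc i) j l)
    first i j l = by-powers (suc i) j l
      (Vanishes-⊗ʳ (q[ l ] ^⊗ γ) (Vanishes-⊗ʳ (q[ j ] ^⊗ β) (Vanishes-q[suc]^ i k≤α)))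

    second : ∀ j l → Vanishes k (t 0 (suc j) l)
    second j l = by-powers 0 (suc j) l
      (Vanishes-⊗ʳ (q[ l ] ^⊗ γ) (Vanishes-⊗ˡ (q[ 0 ] ^⊗ α) (Vanishes-q[suc]^ j k≤β)))

    third : ∀ l → Vanishes k (t 0 0 (suc l))
    third l = by-powers 0 0 (suc l)
      (Vanishes-⊗ˡ (q[ 0 ] ^⊗ α ⊗ q[ 0 ] ^⊗ β) (Vanishes-q[suc]^ l k≤γ))

-- The generating function of the partitions

Λ⟨1R⟩-Partition : Set
Λ⟨1R⟩-Partition = [ π ∈ ColoredPartition ∣ Λ⟨1R⟩ π ]

partition : ∀ {k} → Configuration k → Λ⟨1R⟩-Partition
partition (configuration ch) =
  (_ , [ (sizes≥1 ch , linked ch) ]) , [ ((unique-sizes ch , nonForbidden ch) , 1R∉ ch) ]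

sizes≤sum : ∀ as → All (λ a → size a ≤ sumℕ (map size as)) as
sizes≤sum []       = []
sizes≤sum (a ∷ as) = ℕ.m≤m+n (size a) _ ∷
  All.map (λ b≤ → ℕ.≤-trans b≤ (ℕ.m≤n+m _ (size a))) (sizes≤sum as)

-- No part exceeds the sum of all parts, so a path through `n` sizes reaches every part.
partition-∈ : ∀ n as (p : All (λ a → 1 ≤ size a) as × Linked _≽_ as) →
  (r : Λ⟨1R⟩ (as , [ p ])) → sumℕ (map size as) ≤ n →
  ((as , [ p ]) , [ r ]) ∈ map partition (configurations n)
partition-∈ n as (pos , l) ((u , nf) , 1R∉as) sum≤n
  with s , ch ← chain n pos (descending l u) nf 1R∉as
                  (All.map (λ a≤ → ℕ.≤-trans a≤ sum≤n) (sizes≤sum as)) =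
  ∈-map⁺ partition (configuration-∈ ch)

partitions-unique : ∀ n → Unique (map partition (configurations n))
partitions-unique n = AllPairs.map⁺ (AllPairs.map (λ x≢z eq → x≢z (≡.cong (parts ∘ value) eq))
                                                  (configurations-distinct n))

total-eval : ∀ {I : Set} (f : I → Series) xs m n →
             total (map f xs) m n ≡ sumℤ (map (λ x → f x m n) xs)
total-eval f []       m n = ≡.refl
total-eval f (x ∷ xs) m n = ≡.cong (ℤ._+_ (f x m n)) (total-eval f xs m n)

⊗≡product : ∀ {a a′ b b′ c c′ d d′} → a ≡ a′ → b ≡ b′ → c ≡ c′ → d ≡ d′ →
            a ⊗ b ⊗ c ⊗ d ≡ a′ * b′ * c′ * d′
⊗≡product {a} {_} {b} {_} {c} {_} {d} ≡.refl ≡.refl ≡.refl ≡.refl =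
  ⊗≡ (a * b * c) d (⊗≡ (a * b) c (⊗≡* a b) ≡.refl) ≡.refl

module _ (y₁ y₂ y₃ : Series) where

  GF-summand : Λ⟨1R⟩-Partition → Series
  GF-summand x =
    let π = value x in
    y₁ ^ len R π * y₂ ^ len G π * y₃ ^ len B π * q ^ ∣ π ∣

module _ {y₁ y₂ y₃ : Series} (o₁ : ByyDegree.Vanishes 1 y₁)
         (o₂ : ByyDegree.Vanishes 1 y₂) (o₃ : ByyDegree.Vanishes 1 y₃) where
  open ByqDegree

  weight≡ : ∀ x → weight o₁ o₂ o₃ (parts (value x)) ≡ GF-summand y₁ y₂ y₃ x
  weight≡ x = ⊗≡product
    {y₁ ^⊗ len R π} {y₁ ^ len R π} {y₂ ^⊗ len G π} {y₂ ^ len G π}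
    {y₃ ^⊗ len B π} {y₃ ^ len B π} {q ^⊗ ∣ π ∣} {q ^ ∣ π ∣}
    (^⊗≡^ y₁ (len R π)) (^⊗≡^ y₂ (len G π)) (^⊗≡^ y₃ (len B π)) (^⊗≡^ q ∣ π ∣)
    where π = value x

  Vanishes-q^⊗ : ∀ n → Vanishes n (q ^⊗ n)
  Vanishes-q^⊗ n = ≡.subst (Vanishes n) (≡.sym (^⊗≡^ q n)) (Vanishes-^ q≈[1]0′ n)

  ⊗-≈[]1 : ∀ {k} f g → g ≈[ k ] 1# → f ⊗ g ≈[ k ] f
  ⊗-≈[]1 {k} f g g≈1 = ≡.subst (_≈[ k ] f) (≡.sym (⊗≡* f g))
    (trans[] {k} {f * g} {f * 1#} (*-cong[] {k} {f} {f} {g} (refl[] f) g≈1)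
             (≈⇒≈[] {k} {f * 1#} (S.*-identityʳ f)))

  +-≈[]1 : ∀ {k} f g → f ≈[ k ] 1# → Vanishes k g → f + g ≈[ k ] 1#
  +-≈[]1 f g f≈1 g≈0 m n lt = ≡.trans (≡.cong₂ ℤ._+_ (f≈1 m n lt) (g≈0 m n lt)) (ℤ.+-identityʳ _)

  newPart-vanishes : ∀ a n f → Vanishes n (a ⊗ q ^⊗ n ⊗ f)
  newPart-vanishes a n f = Vanishes-⊗ʳ {f = a ⊗ q ^⊗ n} f (Vanishes-⊗ˡ a (Vanishes-q^⊗ n))

  ZB≈[]1 : ∀ n → ZB o₁ o₂ o₃ n ≈[ n ] 1#
  ZB≈[]1 n = sum≈[]1 y₁ y₂ y₃ (1 ℕ.+ n) (1 ℕ.+ n) n (ℕ.n≤1+n n) (ℕ.n≤1+n n) ℕ.≤-refl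

  ZG≈[]1 : ∀ n → ZG o₁ o₂ o₃ n ≈[ n ] 1#
  ZG≈[]1 n = sum≈[]1 y₁ y₂ y₃ (2 ℕ.+ n) n (1 ℕ.+ n) (ℕ.m≤n+m n 2) ℕ.≤-refl (ℕ.n≤1+n n)

  Y≈[]1 : ∀ n → Y o₁ o₂ o₃ n ≈[ n ] 1#
  Y≈[]1 n = +-≈[]1 (ZB o₁ o₂ o₃ n) _ (ZB≈[]1 n) (newPart-vanishes y₂ n (ZG o₁ o₂ o₃ (suc n)))

  -- Modulo q^n only the empty continuation is left; this turns the conserved total into a count.
  stateSeries≈[]1 : ∀ s n → stateSeries o₁ o₂ o₃ s n ≈[ n ] 1#
  stateSeries≈[]1 free    n =
    +-≈[]1 (Y o₁ o₂ o₃ n) _ (Y≈[]1 n) (newPart-vanishes y₁ n (ZG o₁ o₂ o₃ (suc n)))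
  stateSeries≈[]1 noR     n = Y≈[]1 n
  stateSeries≈[]1 afterRG n = ZG≈[]1 n
  stateSeries≈[]1 afterB  n = ZB≈[]1 n

  summand-outside : ∀ m n x → x ∉ map partition (configurations n) → GF-summand y₁ y₂ y₃ x m n ≡ 0ℤ
  summand-outside m n x@((as , [ p ]) , [ r ]) x∉ with sumℕ (map size as) ℕ.≤? n
  -- The proofs `p` and `r` are available only irrelevantly, which is enough for a contradiction.
  ... | yes sum≤n = ⊥-elim-irr (x∉ (partition-∈ n as p r sum≤n))
  ... | no  sum≰n = ≡.trans (≡.cong (λ s → s m n) (≡.sym (weight≡ x)))
    (Vanishes-⊗ˡ (y₁ ^⊗ len R π ⊗ y₂ ^⊗ len G π ⊗ y₃ ^⊗ len B π) (Vanishes-q^⊗ ∣ π ∣)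
      m n (ℕ.≰⇒> sum≰n))
    where π = value x

  -- For the coefficient of q^n the automaton is stopped after size `n`: the state series at n + 1
  -- are 1 up to and including q^n, so the conserved total `Y 1` reduces to the weights of the
  -- listed partitions. Any partition not listed has sum above `n`.
  isGF : IsGF y₁ y₂ y₃ (Y o₁ o₂ o₃ 1)
  isGF m n = map partition (configurations n) , partitions-unique n , summand-outside m n , sum≡
    where
    open ≡.≡-Reasoning
    summand : Λ⟨1R⟩-Partition → ℤ
    summand x = GF-summand y₁ y₂ y₃ x m n

    summand≡contribution : ∀ (x : Configuration n) →
                           summand (partition x) ≡ contribution o₁ o₂ o₃ x m n
    summand≡contribution x = begin
      summand (partition x)
        ≡⟨ ≡.cong (λ s → s m n) (weight≡ (partition x)) ⟨
      weight o₁ o₂ o₃ (partList x) m n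
        ≡⟨ ⊗-≈[]1 (weight o₁ o₂ o₃ (partList x)) (stateSeries o₁ o₂ o₃ (state x) (suc n))
             (stateSeries≈[]1 (state x) (suc n)) m n ℕ.≤-refl ⟨
      contribution o₁ o₂ o₃ x m n ∎

    sum≡ : sumℤ (map summand (map partition (configurations n))) ≡ Y o₁ o₂ o₃ 1 m n
    sum≡ = begin
      sumℤ (map summand (map partition (configurations n)))
        ≡⟨ ≡.cong sumℤ (map-∘ (configurations n)) ⟨
      sumℤ (map (summand ∘ partition) (configurations n))
        ≡⟨ ≡.cong sumℤ (map-cong summand≡contribution (configurations n)) ⟩
      sumℤ (map (λ x → contribution o₁ o₂ o₃ x m n) (configurations n))
        ≡⟨ total-eval (contribution o₁ o₂ o₃) (configurations n) m n ⟨
      total (map (contribution o₁ o₂ o₃) (configurations n)) m n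
        ≡⟨ configurations-total o₁ o₂ o₃ n m n ⟩
      Y o₁ o₂ o₃ 1 m n ∎

  -- The exponents 4, 2, 1 are the shifts at which `Y₁≈[1+bq]T` factors `Y 1`, and `y₁ ≈ y₂ ⊗ y₃` is
  -- its condition a = bc.
  theorem-at : ∀ {a b c u} → a ≈ y₁ ⊗ q ^⊗ 4 → b ≈ y₂ ⊗ q ^⊗ 2 → c ≈ y₃ ⊗ q ^⊗ 1 →
    y₁ ≈ y₂ ⊗ y₃ → y₂ ⊗ q ≡ u →
    ∃[ GF ] ∃[ T ] (IsGF y₁ y₂ y₃ GF × IsT a b c T × GF ≈ (1# + u) * T)
  theorem-at {a} {b} {c} {u} a≈ b≈ c≈ y₁≈ ≡.refl =
    Y o₁ o₂ o₃ 1 , sum E 4 2 1 y₁ y₂ y₃ , isGF ,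
    IsT-sum {y₁} {y₂} {y₃} {a} {b} {c} o₁ o₂ o₃ 4 2 1 a≈ b≈ c≈ ,
    λ m n → ≡.trans (Y₁≈[1+bq]T o₁ o₂ o₃ y₁≈ m n)
                    (≡.cong (λ s → s m n) (⊗≡* (1# + y₂ ⊗ q) (sum E 4 2 1 y₁ y₂ y₃)))

-- The equations are matched only after y₁, a, b, c, u have been compared as variables.
theorem-literal : ∀ {y₁ a b c u} → y₁ ≡ y ^ 2 → a ≡ y ^ 2 * q ^ 4 → b ≡ y * q ^ 2 → c ≡ y * q →
  u ≡ y * q →
  ∃[ GF ] ∃[ T ] (IsGF y₁ y y GF × IsT a b c T × GF ≈ (1# + u) * T) →
  ∃[ GF ] ∃[ T ] (IsGF (y ^ 2) y y GF × IsT (y ^ 2 * q ^ 4) (y * q ^ 2) (y * q) T ×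
                  GF ≈ (1# + y * q) * T)
theorem-literal ≡.refl ≡.refl ≡.refl ≡.refl ≡.refl p = p

y≈[1]0 : ByyDegree.Vanishes 1 y
y≈[1]0 zero    n lt = ≡.refl
y≈[1]0 (suc m) n (s≤s ())

y²≈[1]0 : ByyDegree.Vanishes 1 (y ^ 2)
y²≈[1]0 = ByyDegree.Vanishes-*ʳ (y ^ 1) y≈[1]0

*≈⊗^ : ∀ f n → f * q ^ n ≈ f ⊗ q ^⊗ n
*≈⊗^ f k m n = ≡.cong (λ s → s m n) (≡.sym (⊗≡ f (q ^ k) ≡.refl (^⊗≡^ q k)))

f*q≈f⊗q¹ : ∀ f → f * q ≈ f ⊗ q ^⊗ 1
f*q≈f⊗q¹ f = P.trans {f * q} {f ⊗ q} {f ⊗ q ^⊗ 1}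
  (λ m n → ≡.cong (λ s → s m n) (≡.sym (⊗≡* f q))) (P.*-congˡ {f} (P.sym (P.*-identityʳ q)))

f^2≈f⊗f : ∀ f → f ^ 2 ≈ f ⊗ f
f^2≈f⊗f f = P.trans {f ^ 2} {f ⊗ (f ⊗ 1#)} {f ⊗ f}
  (λ m n → ≡.cong (λ s → s m n) (≡.sym (^⊗≡^ f 2))) (P.*-congˡ {f} (P.*-identityʳ f))

theorem-variables : ∀ {y₁ a b c u} → y₁ ≡ y ^ 2 → a ≡ y ^ 2 * q ^ 4 → b ≡ y * q ^ 2 → c ≡ y * q →
  u ≡ y * q → ByyDegree.Vanishes 1 y₁ →
  a ≈ y₁ ⊗ q ^⊗ 4 → b ≈ y ⊗ q ^⊗ 2 → c ≈ y ⊗ q ^⊗ 1 → y₁ ≈ y ⊗ y → y ⊗ q ≡ u →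
  ∃[ GF ] ∃[ T ] (IsGF (y ^ 2) y y GF × IsT (y ^ 2 * q ^ 4) (y * q ^ 2) (y * q) T ×
                  GF ≈ (1# + y * q) * T)
theorem-variables {y₁} {a} {b} {c} {u} e₁ e₂ e₃ e₄ e₅ o₁ a≈ b≈ c≈ y₁≈ u≈ =
  theorem-literal {y₁} {a} {b} {c} {u} e₁ e₂ e₃ e₄ e₅
    (theorem-at {y₁} {y} {y} o₁ y≈[1]0 y≈[1]0 {a} {b} {c} {u} a≈ b≈ c≈ y₁≈ u≈)

theorem1p2 : ∃[ GF ] ∃[ T ]
    (IsGF (y ^ 2) y y GF ×
    IsT (y ^ 2 * q ^ 4) (y * q ^ 2) (y * q) T ×
    GF ≈ (1# + y * q) * T)
theorem1p2 = theorem-variables {y ^ 2} {y ^ 2 * q ^ 4} {y * q ^ 2} {y * q} {y * q}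
  ≡.refl ≡.refl ≡.refl ≡.refl ≡.refl
  y²≈[1]0 (*≈⊗^ (y ^ 2) 4) (*≈⊗^ y 2) (f*q≈f⊗q¹ y) (f^2≈f⊗f y) (⊗≡* y q)
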